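{- Let $k = p_1p_2\cdots p_t \geq 6$ be even, where $p_1,\dots,p_t$ are primes, not necessarily distinct. Let $1 \leq i \leq t-1$, and suppose $p_1,\dots,p_i$ are odd primes and at least one of $p_{i+1},\dots,p_t$ equals $2$. If $u \equiv 1 \pmod{p_1p_2\cdots p_i}$ and $g \equiv 0 \pmod{p_{i+1}p_{i+2}\cdots p_t}$, then there exists a $k$-ARCS of $(K_u \times K_g)(2)$.
   Context: $u,g$ are positive integers. For graphs $G,H$, the tensor product $G \times H$ has vertex set $V(G)\times V(H)$, with $(g_1,h_1)$ adjacent to $(g_2,h_2)$ iff $g_1g_2 \in E(G)$ and $h_1h_2 \in E(H)$. For a graph $G$ and positive integer $\lambda$, $G(\lambda)$ is the multigraph obtained by replacing each edge of $G$ by $\lambda$ parallel edges. $K_n$ is the complete graph on $n$ vertices. $(K_u \times K_g)(\lambda)$ is regarded as a $u$-partite multigraph with partite sets $V_j = \{j\}\times V(K_g)$. A partial $C_k$-factor of $(K_u \times K_g)(\lambda)$ is a subgraph which, for some $j$, is a spanning subgraph of $(K_u \times K_g)(\lambda)\setminus V_j$ all of whose components are cycles of length $k$. A $k$-ARCS of $(K_u \times K_g)(\lambda)$ is a partition of its edge multiset into partial $C_k$-factors. -}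

module Defs where

open import Data.Nat using (ℕ; zero; suc; _+_; _<?_)
open import Data.Fin using (Fin; toℕ; fromℕ<) renaming (zero to fz; suc to fs)
import Data.Fin.Properties as FinP
open import Data.Product using (_×_; _,_; proj₁; proj₂)
open import Data.Product.Properties using (≡-dec)
open import Data.Sum using (_⊎_)
open import Relation.Nullary using (¬_; Dec; yes; no)
open import Relation.Nullary.Decidable using (_×-dec_; _⊎-dec_)
open import Relation.Binary.PropositionalEquality using (_≡_; _≢_)
open import Function.Definitions using (Injective)

-- Vertices of K_u × K_g : pairs (j , x) with j ∈ Fin u (part index) and x ∈ Fin g.
V : ℕ → ℕ → Set
V u g = Fin u × Fin g

_≟V_ : ∀ {u g} (v w : V u g) → Dec (v ≡ w)
_≟V_ = ≡-dec FinP._≟_ FinP._≟_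

Adj : ∀ {u g} → V u g → V u g → Set
Adj (a , x) (b , y) = (a ≢ b) × (x ≢ y)

∑ : (n : ℕ) → (Fin n → ℕ) → ℕ
∑ zero    f = 0
∑ (suc n) f = f fz + ∑ n (λ i → f (fs i))

[_] : ∀ {P : Set} → Dec P → ℕ
[ yes _ ] = 1
[ no  _ ] = 0

next : ∀ {n} → Fin n → Fin n
next {suc n} i with suc (toℕ i) <? suc n
... | yes p = fromℕ< p
... | no  _ = fz

sameEdge? : ∀ {u g} (a b x y : V u g) → Dec (((a ≡ x) × (b ≡ y)) ⊎ ((a ≡ y) × (b ≡ x)))
sameEdge? a b x y = ((a ≟V x) ×-dec (b ≟V y)) ⊎-dec ((a ≟V y) ×-dec (b ≟V x))

-- A partial C_k-factor of (K_u × K_g)(λ): a collection of vertex-disjoint k-cycles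
-- (each given by its cyclic vertex sequence c(0),...,c(k-1), edges c(i) c(i+1 mod k))
-- whose vertex sets partition V(K_u × K_g) ∖ V_hole.
record PartialFactor (k u g : ℕ) : Set where
  field
    hole      : Fin u
    ncyc      : ℕ
    cyc       : Fin ncyc → Fin k → V u g
    distinct  : ∀ c → Injective _≡_ _≡_ (cyc c)
    adjacent  : ∀ c i → Adj (cyc c i) (cyc c (next i))
    avoidHole : ∀ c i → proj₁ (cyc c i) ≢ hole
    spanning  : ∀ (v : V u g) → proj₁ v ≢ hole →
                ∑ ncyc (λ c → ∑ k (λ i → [ cyc c i ≟V v ])) ≡ 1

  edgeCount : V u g → V u g → ℕ
  edgeCount x y = ∑ ncyc (λ c → ∑ k (λ i → [ sameEdge? (cyc c i) (cyc c (next i)) x y ]))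

-- A k-ARCS of (K_u × K_g)(λ): a family of partial C_k-factors which together use
-- every edge of K_u × K_g exactly λ times (i.e. they partition the edge multiset
-- of (K_u × K_g)(λ)); cycle edges are edges of K_u × K_g by `adjacent`.
record ARCS (k u g lam : ℕ) : Set where
  field
    nfac    : ℕ
    factor  : Fin nfac → PartialFactor k u g
    exactly : ∀ (x y : V u g) → Adj x y →
              ∑ nfac (λ f → PartialFactor.edgeCount (factor f) x y) ≡ lam

{-# OPTIONS --safe #-}
module Submission where

-- Let m = p₁⋯p_i (odd), n = p_{i+1}⋯p_t (even), u = sm + 1 and g = nr.
--
-- The double complete graph on g points has a C_n-factorization (the "wheel"), obtained from
-- round-robin 1-factorizations.  An m-cycle of K_u lifts to mn-cycles of K_u × K_g which follow the
-- cycles of the wheel, forwards or backwards along each edge, provided the signs sum to ±1 around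
-- the m-cycle; and the lifts of a near C_m-factorization of 2K_u form an ARCS provided the two copies
-- of each edge have opposite signs.  Such signed near factorizations exist for u = m + 1
-- and u = 2m + 1.
--
-- For s ≠ 2, divide u − 1 points into s classes of size m.  Edges inside the classes and at the remaining
-- point are treated by the case u = m + 1, once for each class.  Edges between classes are covered by
-- Hamiltonian cycles of the m-fold blow-ups of n-cycles which alternate between two classes A and ρ_i A,
-- where ρ is an idempotent quasigroup of order s and i is the class of the hole.
--
-- For these explicit cycles it suffices to see that every vertex outside the hole is visited and that
-- every edge is used at least twice: the number of cycles leaves no room for more.

open import Defs
open import Data.Nat as ℕ using (ℕ; zero; suc; _≤_; _<_; _∸_; z≤n; s≤s; z<s)
import Data.Nat.Properties as ℕ
import Data.Nat.DivMod as ℕ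
import Data.Nat.Divisibility as ℕ
open import Data.Nat.Divisibility using (_∣_; divides)
open import Data.Nat.Primality using (Prime; prime[2]; ¬prime[1]; euclidsLemma)
open import Data.Nat.ListAction using (product)
open import Data.Nat.ListAction.Properties using (product-++; ∈⇒∣product)
open import Data.Nat.Tactic.RingSolver using () renaming (solve-∀ to solveℕ-∀)
open import Data.Bool using (Bool; true; false; not)
import Data.Bool.Properties as Bool
open import Data.Unit using (⊤; tt)
open import Data.Empty using (⊥-elim)
open import Data.Maybe using (Maybe; just; nothing)
import Data.Maybe.Properties as Maybe
open import Data.Fin using (Fin; toℕ; fromℕ<; remQuot; _↑ˡ_; _↑ʳ_) renaming (zero to fz; suc to fs)
open import Data.Fin.Properties using (toℕ<n; toℕ-fromℕ<; toℕ-injective; splitAt-↑ˡ; splitAt-↑ʳ; *↔×; +↔⊎; 2↔Bool) renaming (_≟_ to _≟F_)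
open import Data.Product using (∃; _×_; _,_; proj₁; proj₂)
open import Data.Product.Function.NonDependent.Propositional using (_×-↔_)
open import Data.Sum using (_⊎_; inj₁; inj₂)
open import Data.Sum.Function.Propositional using (_⊎-↔_)
open import Data.List using (List; []; _∷_; length; take; drop)
open import Data.List.Properties using (take++drop≡id)
open import Data.List.Relation.Unary.All using (All; []; _∷_)
open import Data.List.Relation.Unary.Any using (Any)
import Data.List.Relation.Unary.Any as Any
open import Function.Bundles using (_↔_; Inverse; mk↔ₛ′)
open import Function.Properties.Inverse using (↔-sym; ↔-trans; ↔-refl)
open import Relation.Nullary using (¬_; Dec; yes; no; ¬?)
open import Relation.Nullary.Decidable using (_×-dec_)
open import Relation.Binary.Definitions using (DecidableEquality; tri<; tri≈; tri>)
open import Relation.Binary.PropositionalEquality hiding ([_])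

-- Over an m-cycle with m odd, a walk along an even cycle of the wheel cannot return after one
-- round. Signs that sum to ±1 advance it by one wheel position per round, so that n rounds close
-- into a single cycle which meets every vertex of the m-cycle over every wheel position exactly
-- once. Opposite signs are required because nothing is known about the directions in which the
-- wheel runs through its edges: over a step from x to y, the edge (a, x)(b, y) needs the arc from a
-- to b, and (a, y)(b, x) needs the reverse arc. The multigraph has u(u - 1)g(g - 1) edges and a
-- factor has (u - 1)g, so each hole gets g - 1 factors: one for each C_n-factor of the wheel. For n
-- = 2 the cycles of the wheel are double edges. The case s = 2 stands apart because no idempotent
-- quasigroup of order 2 exists.

Same : {A : Set} → A → A → A → A → Set
Same p q x y = p ≡ x × q ≡ y ⊎ p ≡ y × q ≡ x

Same-sym : ∀ {A : Set} {p q x y : A} → Same p q x y → Same p q y x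
Same-sym (inj₁ e) = inj₂ e
Same-sym (inj₂ e) = inj₁ e

Same-flip : ∀ {A : Set} {p q x y : A} → Same p q x y → Same q p x y
Same-flip (inj₁ (e , e′)) = inj₂ (e′ , e)
Same-flip (inj₂ (e , e′)) = inj₁ (e′ , e)

Same-map : ∀ {A B : Set} (f : A → B) {p q x y : A} → Same p q x y → Same (f p) (f q) (f x) (f y)
Same-map f (inj₁ (refl , refl)) = inj₁ (refl , refl)
Same-map f (inj₂ (refl , refl)) = inj₂ (refl , refl)

Same-resp : ∀ {A : Set} {p q p′ q′ x y : A} → p′ ≡ p → q′ ≡ q → Same p q x y → Same p′ q′ x y
Same-resp refl refl s = s

-- Double counting: from "at least" to "exactly".

module Counting where
  open import Data.Nat using (_+_; _*_)
  open import Data.Nat.Properties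

  ∑-cong : ∀ n {f f′ : Fin n → ℕ} → (∀ i → f i ≡ f′ i) → ∑ n f ≡ ∑ n f′
  ∑-cong zero    e = refl
  ∑-cong (suc n) e = cong₂ _+_ (e fz) (∑-cong n (λ i → e (fs i)))

  ∑-mono : ∀ n {f f′ : Fin n → ℕ} → (∀ i → f i ≤ f′ i) → ∑ n f ≤ ∑ n f′
  ∑-mono zero    e = z≤n
  ∑-mono (suc n) e = +-mono-≤ (e fz) (∑-mono n (λ i → e (fs i)))

  ∑-+ : ∀ n (f f′ : Fin n → ℕ) → ∑ n (λ i → f i + f′ i) ≡ ∑ n f + ∑ n f′
  ∑-+ zero    f f′ = refl
  ∑-+ (suc n) f f′ rewrite ∑-+ n (λ i → f (fs i)) (λ i → f′ (fs i)) =
    interchange (f fz) (f′ fz) (∑ n (λ i → f (fs i))) (∑ n (λ i → f′ (fs i)))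
    where
    interchange : ∀ a b c d → a + b + (c + d) ≡ a + c + (b + d)
    interchange = solveℕ-∀

  ∑-* : ∀ n c (f : Fin n → ℕ) → ∑ n (λ i → c * f i) ≡ c * ∑ n f
  ∑-* zero    c f = sym (*-zeroʳ c)
  ∑-* (suc n) c f rewrite ∑-* n c (λ i → f (fs i)) = sym (*-distribˡ-+ c _ _)

  ∑-const : ∀ n c → ∑ n (λ _ → c) ≡ n * c
  ∑-const zero    c = refl
  ∑-const (suc n) c = cong (c +_) (∑-const n c)

  ∑-swap : ∀ n m (f : Fin n → Fin m → ℕ) →
           ∑ n (λ i → ∑ m (f i)) ≡ ∑ m (λ j → ∑ n (λ i → f i j))
  ∑-swap zero    m f = sym (trans (∑-const m 0) (*-zeroʳ m))
  ∑-swap (suc n) m f rewrite ∑-swap n m (λ i → f (fs i)) = sym (∑-+ m (f fz) _)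

  ∑-≥ : ∀ n (f : Fin n → ℕ) i → f i ≤ ∑ n f
  ∑-≥ (suc n) f fz     = m≤m+n _ _
  ∑-≥ (suc n) f (fs i) = ≤-trans (∑-≥ n (λ i → f (fs i)) i) (m≤n+m _ _)

  -- The differences `c i ∸ t i` are lost by no term and add up to nothing. This is the step that
  -- turns every lower bound on a number of visits or uses into an equality.
  ∑-tight : ∀ n {t c : Fin n → ℕ} → (∀ i → t i ≤ c i) → ∑ n c ≤ ∑ n t → ∀ i → c i ≡ t i
  ∑-tight (suc n) {t} {c} t≤c s fz = ≤-antisym
    (+-cancelʳ-≤ (∑ n (λ i → c (fs i))) (c fz) (t fz)
      (≤-trans s (+-monoʳ-≤ (t fz) (∑-mono n (λ i → t≤c (fs i)))))) (t≤c fz)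
  ∑-tight (suc n) {t} {c} t≤c s (fs i) = ∑-tight n (λ i → t≤c (fs i))
    (+-cancelˡ-≤ (t fz) _ _ (≤-trans (+-monoˡ-≤ _ (t≤c fz)) s)) i

  ∑-unique : ∀ n (f : Fin n → ℕ) → ∑ n f ≤ 1 → ∀ i j → 1 ≤ f i → 1 ≤ f j → i ≡ j
  ∑-unique (suc n) f s fz     fz     p q = refl
  ∑-unique (suc n) f s fz     (fs j) p q =
    ⊥-elim (<⇒≱ (s≤s (s≤s z≤n)) (≤-trans (+-mono-≤ p (≤-trans q (∑-≥ n (λ i → f (fs i)) j))) s))
  ∑-unique (suc n) f s (fs i) fz     p q = sym (∑-unique (suc n) f s fz (fs i) q p)
  ∑-unique (suc n) f s (fs i) (fs j) p q =
    cong fs (∑-unique n (λ i → f (fs i)) (≤-trans (m≤n+m _ (f fz)) s) i j p q)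

  []-yes : ∀ {P : Set} (d : Dec P) → P → [ d ] ≡ 1
  []-yes (yes _) p = refl
  []-yes (no ¬p) p = ⊥-elim (¬p p)

  []-no : ∀ {P : Set} (d : Dec P) → ¬ P → [ d ] ≡ 0
  []-no (yes p) ¬p = ⊥-elim (¬p p)
  []-no (no _)  ¬p = refl

  []-⇔ : ∀ {P Q : Set} (d : Dec P) (e : Dec Q) → (P → Q) → (Q → P) → [ d ] ≡ [ e ]
  []-⇔ (yes p) e f g = sym ([]-yes e (f p))
  []-⇔ (no ¬p) e f g = sym ([]-no e (λ q → ¬p (g q)))

  []-×-dec : ∀ {P Q : Set} (d : Dec P) (e : Dec Q) → [ d ×-dec e ] ≡ [ d ] * [ e ]
  []-×-dec (yes p) (yes q) = refl
  []-×-dec (yes p) (no ¬q) = refl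
  []-×-dec (no ¬p) e       = []-no (no ¬p ×-dec e) (λ pq → ¬p (proj₁ pq))

  ∑-δ : ∀ n (a : Fin n) → ∑ n (λ x → [ a ≟F x ]) ≡ 1
  ∑-δ (suc n) fz     = cong suc (trans (∑-cong n (λ x → []-no (fz ≟F fs x) (λ ())))
    (trans (∑-const n 0) (*-zeroʳ n)))
  ∑-δ (suc n) (fs a) = trans (∑-cong n (λ x → []-⇔ (fs a ≟F fs x) (a ≟F x) (λ { refl → refl }) (cong fs)))
    (∑-δ n a)

  ∑-δᶜ : ∀ {n n′} → n ≡ suc n′ → (a : Fin n) → ∑ n (λ x → [ ¬? (a ≟F x) ]) ≡ n′
  ∑-δᶜ {n} {n′} n≡ a = suc-injective (begin
    1 + ∑ n ne                  ≡⟨ cong (_+ ∑ n ne) (sym (∑-δ n a)) ⟩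
    ∑ n eq + ∑ n ne             ≡⟨ sym (∑-+ n eq ne) ⟩
    ∑ n (λ x → eq x + ne x)     ≡⟨ ∑-cong n (λ x → compl (a ≟F x)) ⟩
    ∑ n (λ _ → 1)               ≡⟨ ∑-const n 1 ⟩
    n * 1                       ≡⟨ *-identityʳ n ⟩
    n                           ≡⟨ n≡ ⟩
    suc n′                      ∎)
    where
    open ≡-Reasoning
    eq ne : Fin n → ℕ
    eq x = [ a ≟F x ]
    ne x = [ ¬? (a ≟F x) ]
    compl : ∀ {P : Set} (d : Dec P) → [ d ] + [ ¬? d ] ≡ 1
    compl (yes _) = refl
    compl (no _)  = refl

  ∑² : ∀ u g → (V u g → ℕ) → ℕ
  ∑² u g f = ∑ u (λ a → ∑ g (λ x → f (a , x)))

  ∑²-cong : ∀ u g {f f′ : V u g → ℕ} → (∀ v → f v ≡ f′ v) → ∑² u g f ≡ ∑² u g f′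
  ∑²-cong u g e = ∑-cong u (λ a → ∑-cong g (λ x → e (a , x)))

  ∑²-mono : ∀ u g {f f′ : V u g → ℕ} → (∀ v → f v ≤ f′ v) → ∑² u g f ≤ ∑² u g f′
  ∑²-mono u g e = ∑-mono u (λ a → ∑-mono g (λ x → e (a , x)))

  ∑²-+ : ∀ u g (f f′ : V u g → ℕ) → ∑² u g (λ v → f v + f′ v) ≡ ∑² u g f + ∑² u g f′
  ∑²-+ u g f f′ = trans (∑-cong u (λ a → ∑-+ g _ _)) (∑-+ u _ _)

  ∑²-* : ∀ u g c (f : V u g → ℕ) → ∑² u g (λ v → c * f v) ≡ c * ∑² u g f
  ∑²-* u g c f = trans (∑-cong u (λ a → ∑-* g c _)) (∑-* u c _)

  ∑²-swap : ∀ u g n (f : V u g → Fin n → ℕ) →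
            ∑² u g (λ v → ∑ n (f v)) ≡ ∑ n (λ j → ∑² u g (λ v → f v j))
  ∑²-swap u g n f = trans (∑-cong u (λ a → ∑-swap g n _)) (∑-swap u n _)

  ∑²-tight : ∀ u g {t c : V u g → ℕ} → (∀ v → t v ≤ c v) → ∑² u g c ≤ ∑² u g t → ∀ v → c v ≡ t v
  ∑²-tight u g t≤c s (a , x) = ∑-tight g (λ x → t≤c (a , x))
    (≤-reflexive (∑-tight u (λ a → ∑-mono g (λ x → t≤c (a , x))) s a)) x

  ∑²-δ : ∀ u g (w : V u g) → ∑² u g (λ v → [ w ≟V v ]) ≡ 1
  ∑²-δ u g (a , x) = begin
    ∑ u (λ b → ∑ g (λ y → [ (a , x) ≟V (b , y) ]))
      ≡⟨ ∑-cong u (λ b → ∑-cong g (λ y → trans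
           ([]-⇔ ((a , x) ≟V (b , y)) ((a ≟F b) ×-dec (x ≟F y)) (λ { refl → refl , refl })
             (λ { (refl , refl) → refl }))
           ([]-×-dec (a ≟F b) (x ≟F y)))) ⟩
    ∑ u (λ b → ∑ g (λ y → [ a ≟F b ] * [ x ≟F y ]))
      ≡⟨ ∑-cong u (λ b → trans (∑-* g [ a ≟F b ] _) (trans (cong ([ a ≟F b ] *_) (∑-δ g x))
        (*-identityʳ _))) ⟩
    ∑ u (λ b → [ a ≟F b ]) ≡⟨ ∑-δ u a ⟩
    1 ∎
    where open ≡-Reasoning

  adj? : ∀ {u g} (v w : V u g) → Dec (Adj v w)
  adj? (a , x) (b , y) = ¬? (a ≟F b) ×-dec ¬? (x ≟F y)

  -- A 2-fold k-ARCS with "exactly" weakened to "at least": γ h d c runs through the c-th cycle of the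
  -- d-th factor with hole h.  The labels, two for each edge, make the two uses of an edge distinct.
  record Scheme (U G D C : Set) (k : ℕ) : Set where
    field
      γ      : U → D → C → ℕ → U × G
      lab    : U → D → C → ℕ → Bool
      closed : ∀ h d c → γ h d c k ≡ γ h d c 0
      covers : ∀ h d a x → a ≢ h → ∃ λ c → ∃ λ i → i < k × γ h d c i ≡ (a , x)
      joins  : ∀ a b x y → a ≢ b → x ≢ y → ∀ ℓ → ∃ λ h → ∃ λ d → ∃ λ c → ∃ λ i →
               i < k × lab h d c i ≡ ℓ ×
               Same (γ h d c i) (γ h d c (suc i)) (a , x) (b , y)

  toℕ-next : ∀ {k} {A : Set} (f : ℕ → A) → f k ≡ f 0 → (i : Fin k) → f (toℕ (next i)) ≡ f (suc (toℕ i))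
  toℕ-next {suc n} f e i with suc (toℕ i) ℕ.<? suc n
  ... | yes p = cong f (toℕ-fromℕ< p)
  ... | no ¬p = trans (sym e) (cong f (≤-antisym (≮⇒≥ ¬p) (toℕ<n i)))

  -- Only an inequality, since `p ≢ q` is not yet known at this stage: for `p = q = v = w` the right
  -- side is 2.
  sameEdge-≤ : ∀ {u g} (p q v w : V u g) →
               [ sameEdge? p q v w ] ≤ [ p ≟V v ] * [ q ≟V w ] + [ p ≟V w ] * [ q ≟V v ]
  sameEdge-≤ p q v w with sameEdge? p q v w
  ... | no _ = z≤n
  ... | yes (inj₁ (e , e′)) rewrite []-yes (p ≟V v) e | []-yes (q ≟V w) e′ = s≤s z≤n
  ... | yes (inj₂ (e , e′)) rewrite []-yes (p ≟V w) e | []-yes (q ≟V v) e′ = m≤n+m 1 _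

  ∑-sameEdge : ∀ u g (p q : V u g) → ∑² u g (λ v → ∑² u g (λ w → [ sameEdge? p q v w ])) ≤ 2
  ∑-sameEdge u g p q = begin
    ∑² u g (λ v → ∑² u g (λ w → [ sameEdge? p q v w ]))
      ≤⟨ ∑²-mono u g (λ v → ∑²-mono u g (λ w → sameEdge-≤ p q v w)) ⟩
    ∑² u g (λ v → ∑² u g (λ w → [ p ≟V v ] * [ q ≟V w ] + [ p ≟V w ] * [ q ≟V v ]))
      ≡⟨ ∑²-cong u g (λ v → trans (∑²-+ u g _ _) (cong₂ _+_ (δ q [ p ≟V v ])
           (trans (∑²-cong u g (λ w → *-comm [ p ≟V w ] [ q ≟V v ])) (δ p [ q ≟V v ])))) ⟩
    ∑² u g (λ v → [ p ≟V v ] + [ q ≟V v ]) ≡⟨ ∑²-+ u g _ _ ⟩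
    ∑² u g (λ v → [ p ≟V v ]) + ∑² u g (λ v → [ q ≟V v ]) ≡⟨ cong₂ _+_ (∑²-δ u g p) (∑²-δ u g q) ⟩
    2 ∎
    where
    open ≤-Reasoning
    δ : ∀ r c → ∑² u g (λ w → c * [ r ≟V w ]) ≡ c
    δ r c = trans (∑²-* u g c _) (trans (cong (c *_) (∑²-δ u g r)) (*-identityʳ c))

  -- By `size`, a factor has as many positions as there are vertices outside its hole. The `u * g′`
  -- factors then have `u * g′ * u′ * g` steps in total, which is twice the number of edges, so
  -- neither count leaves any slack.
  module _ {u g u′ g′ nc k : ℕ} (u≡ : u ≡ suc u′) (g≡ : g ≡ suc g′)
           (S : Scheme (Fin u) (Fin g) (Fin g′) (Fin nc) k) (size : nc * k ≡ u′ * g) where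
    private
      open Scheme S

      at at⁺ : Fin u → Fin g′ → Fin nc → Fin k → V u g
      at  h d c i = γ h d c (toℕ i)
      at⁺ h d c i = at h d c (next i)

      visits : Fin u → Fin g′ → V u g → ℕ
      visits h d v = ∑ nc (λ c → ∑ k (λ i → [ at h d c i ≟V v ]))

      outside : Fin u → V u g → ℕ
      outside h v = [ ¬? (h ≟F proj₁ v) ]

      outside≤visits : ∀ h d v → outside h v ≤ visits h d v
      outside≤visits h d v@(a , x) with h ≟F a
      ... | yes _  = z≤n
      ... | no h≢a with covers h d a x (λ e → h≢a (sym e))
      ...   | c , i , i<k , e = begin
        1                                        ≡⟨ sym ([]-yes (at h d c i′ ≟V v)
          (trans (cong (γ h d c) (toℕ-fromℕ< i<k)) e)) ⟩
        [ at h d c i′ ≟V v ]                     ≤⟨ ∑-≥ k (λ i → [ at h d c i ≟V v ]) i′ ⟩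
        ∑ k (λ i → [ at h d c i ≟V v ])          ≤⟨ ∑-≥ nc _ c ⟩
        visits h d v                             ∎
        where
        open ≤-Reasoning
        i′ = fromℕ< i<k

      ∑-visits : ∀ h d → ∑² u g (visits h d) ≡ ∑² u g (outside h)
      ∑-visits h d = begin
        ∑² u g (visits h d)                      ≡⟨ ∑²-swap u g nc _ ⟩
        ∑ nc (λ c → ∑² u g (λ v → ∑ k (λ i → [ at h d c i ≟V v ])))
          ≡⟨ ∑-cong nc (λ c → trans (∑²-swap u g k _) (∑-cong k (λ i → ∑²-δ u g (at h d c i)))) ⟩
        ∑ nc (λ c → ∑ k (λ _ → 1))               ≡⟨ ∑-cong nc (λ _ → trans (∑-const k 1) (*-identityʳ k)) ⟩
        ∑ nc (λ c → k)                           ≡⟨ ∑-const nc k ⟩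
        nc * k                                   ≡⟨ size ⟩
        u′ * g                                   ≡⟨ *-comm u′ g ⟩
        g * u′                                   ≡⟨ cong (g *_) (sym (∑-δᶜ u≡ h)) ⟩
        g * ∑ u (λ a → [ ¬? (h ≟F a) ])          ≡⟨ sym (∑-* u g _) ⟩
        ∑ u (λ a → g * [ ¬? (h ≟F a) ])          ≡⟨ ∑-cong u (λ a → sym (∑-const g _)) ⟩
        ∑² u g (outside h)                       ∎
        where open ≡-Reasoning

      visits≡outside : ∀ h d v → visits h d v ≡ outside h v
      visits≡outside h d = ∑²-tight u g (outside≤visits h d) (≤-reflexive (∑-visits h d))

      ∑∑ : (Fin u → Fin g′ → Fin nc → Fin k → ℕ) → ℕ
      ∑∑ F = ∑ u (λ h → ∑ g′ (λ d → ∑ nc (λ c → ∑ k (F h d c))))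

      ∑∑-cong : ∀ {F F′} → (∀ h d c i → F h d c i ≡ F′ h d c i) → ∑∑ F ≡ ∑∑ F′
      ∑∑-cong e = ∑-cong u (λ h → ∑-cong g′ (λ d → ∑-cong nc (λ c → ∑-cong k (e h d c))))

      ∑∑-+ : ∀ F F′ → ∑∑ (λ h d c i → F h d c i + F′ h d c i) ≡ ∑∑ F + ∑∑ F′
      ∑∑-+ F F′ = trans (∑-cong u (λ h → trans (∑-cong g′ (λ d → trans (∑-cong nc (λ c → ∑-+ k _ _))
        (∑-+ nc _ _))) (∑-+ g′ _ _))) (∑-+ u _ _)

      ∑∑-≥ : ∀ F h d c i → F h d c i ≤ ∑∑ F
      ∑∑-≥ F h d c i = ≤-trans (∑-≥ k (F h d c) i) (≤-trans (∑-≥ nc _ c) (≤-trans (∑-≥ g′ _ d) (∑-≥ u _ h)))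

      ∑∑-swap : ∀ (F : V u g → _) → ∑² u g (λ v → ∑∑ (F v)) ≡ ∑∑ (λ h d c i → ∑² u g (λ v → F v h d c i))
      ∑∑-swap F = trans (∑²-swap u g u _) (∑-cong u (λ h → trans (∑²-swap u g g′ _) (∑-cong g′ (λ d →
        trans (∑²-swap u g nc _) (∑-cong nc (λ c → ∑²-swap u g k _))))))

      uses : V u g → V u g → ℕ
      uses v w = ∑∑ (λ h d c i → [ sameEdge? (at h d c i) (at⁺ h d c i) v w ])

      twice : V u g → V u g → ℕ
      twice v w = 2 * [ adj? v w ]

      labelled : Bool → V u g → V u g → Fin u → Fin g′ → Fin nc → Fin k → ℕ
      labelled ℓ v w h d c i = [ sameEdge? (at h d c i) (at⁺ h d c i) v w ] * [ lab h d c (toℕ i) Bool.≟ ℓ ]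

      uses-split : ∀ v w → uses v w ≡ ∑∑ (labelled true v w) + ∑∑ (labelled false v w)
      uses-split v w = trans (∑∑-cong (λ h d c i → split _ (lab h d c (toℕ i)))) (∑∑-+ _ _)
        where
        split : ∀ e ℓ → e ≡ e * [ ℓ Bool.≟ true ] + e * [ ℓ Bool.≟ false ]
        split e true  = sym (trans (cong₂ _+_ (*-identityʳ e) (*-zeroʳ e)) (+-identityʳ e))
        split e false = sym (trans (cong₂ _+_ (*-zeroʳ e) (*-identityʳ e)) refl)

      labelled≥1 : ∀ v w → Adj v w → ∀ ℓ → 1 ≤ ∑∑ (labelled ℓ v w)
      labelled≥1 v@(a , x) w@(b , y) (a≢b , x≢y) ℓ with joins a b x y a≢b x≢y ℓ
      ... | h , d , c , i , i<k , l , e = begin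
        1                                        ≡⟨ sym (cong₂ _*_
          ([]-yes (sameEdge? (at h d c i′) (at⁺ h d c i′) v w) (same e))
                                                      ([]-yes (lab h d c (toℕ i′) Bool.≟ ℓ)
                                                        (trans (cong (lab h d c) i≡) l))) ⟩
        labelled ℓ v w h d c i′                  ≤⟨ ∑∑-≥ (labelled ℓ v w) h d c i′ ⟩
        ∑∑ (labelled ℓ v w)                      ∎
        where
        open ≤-Reasoning
        i′ = fromℕ< i<k
        i≡ : toℕ i′ ≡ i
        i≡ = toℕ-fromℕ< i<k
        here : at h d c i′ ≡ γ h d c i
        here = cong (γ h d c) i≡
        there : at⁺ h d c i′ ≡ γ h d c (suc i)
        there = trans (toℕ-next (γ h d c) (closed h d c) i′) (cong (λ j → γ h d c (suc j)) i≡)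
        same : ∀ {p q r s : V u g} → (γ h d c i ≡ p × γ h d c (suc i) ≡ q ⊎ γ h d c i ≡ r × γ h d c
          (suc i) ≡ s) →
               (at h d c i′ ≡ p × at⁺ h d c i′ ≡ q ⊎ at h d c i′ ≡ r × at⁺ h d c i′ ≡ s)
        same (inj₁ (e₁ , e₂)) = inj₁ (trans here e₁ , trans there e₂)
        same (inj₂ (e₁ , e₂)) = inj₂ (trans here e₁ , trans there e₂)

      twice≤uses : ∀ v w → twice v w ≤ uses v w
      twice≤uses v w with adj? v w
      ... | no _  = z≤n
      ... | yes p = ≤-trans (+-mono-≤ (labelled≥1 v w p true) (labelled≥1 v w p false))
        (≤-reflexive (sym (uses-split v w)))

      ∑-uses : ∑² u g (λ v → ∑² u g (uses v)) ≤ ∑² u g (λ v → ∑² u g (twice v))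
      ∑-uses = begin
        ∑² u g (λ v → ∑² u g (uses v))
          ≡⟨ trans (∑²-cong u g (λ v → ∑∑-swap _)) (∑∑-swap _) ⟩
        ∑∑ (λ h d c i → ∑² u g (λ v → ∑² u g (λ w → [ sameEdge? (at h d c i) (at⁺ h d c i) v w ])))
          ≤⟨ ∑-mono u (λ h → ∑-mono g′ (λ d → ∑-mono nc (λ c → ∑-mono k (λ i → ∑-sameEdge u g _ _)))) ⟩
        ∑∑ (λ _ _ _ _ → 2)
          ≡⟨ trans (∑-cong u (λ _ → trans (∑-cong g′ (λ _ → trans (∑-cong nc (λ _ → ∑-const k 2))
            (∑-const nc _))) (∑-const g′ _))) (∑-const u _) ⟩
        u * (g′ * (nc * (k * 2)))
          ≡⟨ cong (λ z → u * (g′ * z)) (trans (sym (*-assoc nc k 2)) (cong (_* 2) size)) ⟩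
        u * (g′ * (u′ * g * 2))
          ≡⟨ rearrange u g′ u′ g ⟩
        u * (g * (2 * (u′ * g′)))
          ≡⟨ sym (trans (∑-cong u (λ _ → ∑-const g _)) (∑-const u _)) ⟩
        ∑² u g (λ v → 2 * (u′ * g′))
          ≡⟨ ∑²-cong u g (λ v → sym (neighbours v)) ⟩
        ∑² u g (λ v → ∑² u g (twice v)) ∎
        where
        open ≤-Reasoning
        rearrange : ∀ a b c d → a * (b * (c * d * 2)) ≡ a * (d * (2 * (c * b)))
        rearrange = solveℕ-∀
        neighbours : ∀ v → ∑² u g (twice v) ≡ 2 * (u′ * g′)
        neighbours v@(a , x) = trans (∑²-* u g 2 _) (cong (2 *_) (trans
          (∑-cong u (λ b → trans (∑-cong g (λ y → []-×-dec (¬? (a ≟F b)) (¬? (x ≟F y))))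
            (trans (∑-* g [ ¬? (a ≟F b) ] _) (trans (cong ([ ¬? (a ≟F b) ] *_) (∑-δᶜ g≡ x))
              (*-comm _ g′)))))
          (trans (∑-* u g′ _) (trans (cong (g′ *_) (∑-δᶜ u≡ a)) (*-comm g′ u′)))))

      -- Tightness is applied to the sums over `w` for each `v`, and then inside each of these sums.
      uses≡twice : ∀ v w → uses v w ≡ twice v w
      uses≡twice v = ∑²-tight u g (twice≤uses v)
        (≤-reflexive (∑²-tight u g (λ v → ∑²-mono u g (twice≤uses v)) ∑-uses v))

      -- Adjacency is a consequence of the count as well: a step between nonadjacent vertices would
      -- be a use of a pair for which `uses` is 0.
      consecutive-adj : ∀ h d c i → Adj (at h d c i) (at⁺ h d c i)
      consecutive-adj h d c i with adj? (at h d c i) (at⁺ h d c i) | uses≡twice (at h d c i) (at⁺ h d c i)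
      ... | yes p | _ = p
      ... | no  _ | e = ⊥-elim (<⇒≱ (s≤s z≤n) (begin
        1                                        ≡⟨ sym ([]-yes (sameEdge? p q p q) (inj₁ (refl , refl))) ⟩
        [ sameEdge? p q p q ]                    ≤⟨ ∑∑-≥ (λ h d c i → [ sameEdge? (at h d c i)
          (at⁺ h d c i) p q ]) h d c i ⟩
        uses p q                                 ≡⟨ e ⟩
        0                                        ∎))
        where
        open ≤-Reasoning
        p = at h d c i
        q = at⁺ h d c i

      visited : ∀ h d c i → 1 ≤ visits h d (at h d c i)
      visited h d c i = ≤-trans (≤-reflexive (sym ([]-yes (at h d c i ≟V at h d c i) refl)))
        (≤-trans (∑-≥ k (λ j → [ at h d c j ≟V at h d c i ]) i) (∑-≥ nc _ c))

      avoid : ∀ h d c i → proj₁ (at h d c i) ≢ h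
      avoid h d c i e with h ≟F proj₁ (at h d c i) | visits≡outside h d (at h d c i)
      ... | yes _ | z = <⇒≱ (visited h d c i) (≤-reflexive z)
      ... | no ne | _ = ne (sym e)

      visits≤1 : ∀ h d v → visits h d v ≤ 1
      visits≤1 h d v = ≤-trans (≤-reflexive (visits≡outside h d v)) (ind (¬? (h ≟F proj₁ v)))
        where
        ind : ∀ {P : Set} (d : Dec P) → [ d ] ≤ 1
        ind (yes _) = s≤s z≤n
        ind (no _)  = z≤n

      dist : ∀ h d c {i j} → at h d c i ≡ at h d c j → i ≡ j
      dist h d c {i} {j} e = ∑-unique k (λ i′ → [ at h d c i′ ≟V at h d c j ])
        (≤-trans (∑-≥ nc _ c) (visits≤1 h d (at h d c j))) i j
        (≤-reflexive (sym ([]-yes (at h d c i ≟V at h d c j) e)))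
        (≤-reflexive (sym ([]-yes (at h d c j ≟V at h d c j) refl)))

      factor′ : Fin u → Fin g′ → PartialFactor k u g
      factor′ h d = record
        { hole      = h
        ; ncyc      = nc
        ; cyc       = at h d
        ; distinct  = dist h d
        ; adjacent  = consecutive-adj h d
        ; avoidHole = avoid h d
        ; spanning  = λ v v∉h → trans (visits≡outside h d v)
          ([]-yes (¬? (h ≟F proj₁ v)) (λ e → v∉h (sym e)))
        }

    scheme⇒ARCS : ARCS k u g 2
    scheme⇒ARCS = record
      { nfac    = u * g′
      ; factor  = λ f → let (h , d) = remQuot {u} g′ f in factor′ h d
      ; exactly = λ v w p → trans (∑-remQuot u g′ (λ h d → PartialFactor.edgeCount (factor′ h d) v w))
                              (trans (uses≡twice v w) (cong (2 *_) ([]-yes (adj? v w) p)))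
      }
      where
      ∑-++ : ∀ a b (f : Fin (a + b) → ℕ) → ∑ (a + b) f ≡ ∑ a (λ i → f (i ↑ˡ b)) + ∑ b (λ j → f (a ↑ʳ j))
      ∑-++ zero    b f = refl
      ∑-++ (suc a) b f = trans (cong (f fz +_) (∑-++ a b (λ i → f (fs i)))) (sym (+-assoc (f fz) _ _))
      ∑-remQuot : ∀ a b (f : Fin a → Fin b → ℕ) →
                  ∑ (a * b) (λ q → f (proj₁ (remQuot {a} b q)) (proj₂ (remQuot {a} b q))) ≡ ∑ a
                    (λ i → ∑ b (f i))
      ∑-remQuot zero    b f = refl
      ∑-remQuot (suc a) b f = trans (∑-++ b (a * b) _) (cong₂ _+_
        (∑-cong b (λ j → first j))
        (trans (∑-cong (a * b) (λ q → rest q)) (∑-remQuot a b (λ i → f (fs i)))))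
        where
        F : Fin (suc a) × Fin b → ℕ
        F (i , j) = f i j
        first : ∀ j → F (remQuot {suc a} b (j ↑ˡ (a * b))) ≡ f fz j
        first j rewrite splitAt-↑ˡ b j (a * b) = refl
        rest : ∀ q → F (remQuot {suc a} b (b ↑ʳ q)) ≡ f (fs (proj₁ (remQuot {a} b q)))
          (proj₂ (remQuot {a} b q))
        rest q rewrite splitAt-↑ʳ b (a * b) q = refl

open Counting using (Scheme; scheme⇒ARCS)
open import Data.Integer using (ℤ; +_; -[1+_]; _+_; _*_; _-_; -_; 0ℤ; 1ℤ; -1ℤ)
import Data.Integer.Properties as ℤ
open import Data.Integer.DivMod using (_%ℕ_; _/ℕ_; n%ℕd<d; a≡a%ℕn+[a/ℕn]*n)
open import Data.Integer.Tactic.RingSolver using (solve-∀)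

transport : ∀ {U G D C U′ G′ D′ C′ : Set} {k} → U ↔ U′ → G ↔ G′ → D ↔ D′ → C ↔ C′ →
            Scheme U G D C k → Scheme U′ G′ D′ C′ k
transport {U} {G} {D} {C} {U′} {G′} {D′} {C′} {k} iU iG iD iC S = record
  { γ      = λ h d c i → f (γ (U.from h) (D.from d) (C.from c) i)
  ; lab    = λ h d c → lab (U.from h) (D.from d) (C.from c)
  ; closed = λ h d c → cong f (closed (U.from h) (D.from d) (C.from c))
  ; covers = λ h d a x a≢h →
      let c , i , i<k , e = covers (U.from h) (D.from d) (U.from a) (G.from x) (λ e → a≢h (from-injective iU e))
      in C.to c , i , i<k , trans (cong (λ c → f (γ (U.from h) (D.from d) c i)) (C.strictlyInverseʳ c))
        (back e)
  ; joins  = joins′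
  }
  where
  open Scheme S
  module U = Inverse iU
  module G = Inverse iG
  module D = Inverse iD
  module C = Inverse iC
  f : U × G → U′ × G′
  f (a , x) = U.to a , G.to x
  from-injective : ∀ {A B : Set} (i : A ↔ B) {x y} → Inverse.from i x ≡ Inverse.from i y → x ≡ y
  from-injective i {x} {y} e = trans (sym (Inverse.strictlyInverseˡ i x))
    (trans (cong (Inverse.to i) e) (Inverse.strictlyInverseˡ i y))
  back : ∀ {w a x} → w ≡ (U.from a , G.from x) → f w ≡ (a , x)
  back {a = a} {x} refl = cong₂ _,_ (U.strictlyInverseˡ a) (G.strictlyInverseˡ x)
  joins′ : ∀ a b x y → a ≢ b → x ≢ y → ∀ ℓ → _
  joins′ a b x y a≢b x≢y ℓ
    with joins (U.from a) (U.from b) (G.from x) (G.from y)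
           (λ e → a≢b (from-injective iU e)) (λ e → x≢y (from-injective iG e)) ℓ
  ... | h , d , c , i , i<k , l , e
    rewrite sym (U.strictlyInverseʳ h) | sym (D.strictlyInverseʳ d) | sym (C.strictlyInverseʳ c) =
    U.to h , D.to d , C.to c , i , i<k , l , both e
    where
    both : ∀ {v w} → v ≡ (U.from a , G.from x) × w ≡ (U.from b , G.from y) ⊎
                     v ≡ (U.from b , G.from y) × w ≡ (U.from a , G.from x) →
            f v ≡ (a , x) × f w ≡ (b , y) ⊎ f v ≡ (b , y) × f w ≡ (a , x)
    both (inj₁ (e₁ , e₂)) = inj₁ (back e₁ , back e₂)
    both (inj₂ (e₁ , e₂)) = inj₂ (back e₁ , back e₂)

-- Arithmetic modulo N.

ι : ∀ {N} → Fin N → ℤ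
ι x = + toℕ x

module Residue (N′ : ℕ) where
  N : ℕ
  N = suc N′

  abstract
    ⟦_⟧ : ℤ → Fin N
    ⟦ z ⟧ = fromℕ< (n%ℕd<d z N)

    ι⟦⟧ : ∀ z → ι ⟦ z ⟧ ≡ + (z %ℕ N)
    ι⟦⟧ z = cong +_ (toℕ-fromℕ< (n%ℕd<d z N))

  lift : ∀ z → z ≡ ι ⟦ z ⟧ + z /ℕ N * + N
  lift z = trans (a≡a%ℕn+[a/ℕn]*n z N) (cong (_+ z /ℕ N * + N) (sym (ι⟦⟧ z)))

  private
    no-shift : ∀ (r r′ : Fin N) n → ι r ≢ ι r′ + + suc n * + N
    no-shift r r′ n e = ℕ.<⇒≱ (toℕ<n r) (ℕ.≤-trans (ℕ.≤-trans (ℕ.m≤m+n N (n ℕ.* N)) (ℕ.m≤n+m _ (toℕ r′)))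
      (ℕ.≤-reflexive (sym (ℤ.+-injective (trans e (trans (cong (λ z → ι r′ + z) (sym (ℤ.pos-* (suc n) N)))
        (sym (ℤ.pos-+ (toℕ r′) _))))))))

    shift-zero : ∀ (r r′ : Fin N) k → ι r ≡ ι r′ + k * + N → r ≡ r′
    shift-zero r r′ (+ zero) e = toℕ-injective (ℤ.+-injective (trans e (zeroʳ (ι r′) (+ N))))
      where
      zeroʳ : ∀ a b → a + 0ℤ * b ≡ a
      zeroʳ = solve-∀
    shift-zero r r′ (+ suc n) e = ⊥-elim (no-shift r r′ n e)
    shift-zero r r′ -[1+ n ] e = ⊥-elim (no-shift r′ r n (trans (flip (ι r′) (+ suc n) (+ N))
      (cong (_+ + suc n * + N) (sym e))))
      where
      flip : ∀ a b c → a ≡ (a + (- b) * c) + b * c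
      flip = solve-∀

  -- The multiple `k` of the modulus is given explicitly, so that a congruence becomes a polynomial
  -- identity over ℤ which the ring solver can settle.
  ⟦⟧-cong : ∀ {a b} k → a ≡ b + k * + N → ⟦ a ⟧ ≡ ⟦ b ⟧
  ⟦⟧-cong {a} {b} k e = shift-zero ⟦ a ⟧ ⟦ b ⟧ (b /ℕ N + k - a /ℕ N)
    (trans (move (ι ⟦ a ⟧) (a /ℕ N) (+ N)) (trans (cong (_- a /ℕ N * + N)
      (trans (sym (lift a)) (trans e (cong (_+ k * + N) (lift b)))))
      (collect (ι ⟦ b ⟧) (b /ℕ N) k (a /ℕ N) (+ N))))
    where
    move : ∀ r q n → r ≡ (r + q * n) - q * n
    move = solve-∀
    collect : ∀ r q k q′ n → (r + q * n + k * n) - q′ * n ≡ r + (q + k - q′) * n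
    collect = solve-∀

  ⟦⟧-injective : ∀ {a b} → ⟦ a ⟧ ≡ ⟦ b ⟧ → ∃ λ k → a ≡ b + k * + N
  ⟦⟧-injective {a} {b} e = a /ℕ N - b /ℕ N , trans (lift a) (trans (cong (λ r → ι r + a /ℕ N * + N) e)
    (trans (regroup (ι ⟦ b ⟧) (a /ℕ N) (b /ℕ N) (+ N)) (cong (_+ (a /ℕ N - b /ℕ N) * + N) (sym (lift b)))))
    where
    regroup : ∀ r q q′ n → r + q * n ≡ (r + q′ * n) + (q - q′) * n
    regroup = solve-∀

  ⟦ι⟧ : ∀ x → ⟦ ι x ⟧ ≡ x
  ⟦ι⟧ x = sym (shift-zero x ⟦ ι x ⟧ (ι x /ℕ N) (lift (ι x)))

  ⟦ι⟧-cong : ∀ {a x} k → a ≡ ι x + k * + N → ⟦ a ⟧ ≡ x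
  ⟦ι⟧-cong {x = x} k e = trans (⟦⟧-cong {b = ι x} k e) (⟦ι⟧ x)

  absorb : ∀ z w → ⟦ ι ⟦ z ⟧ + w ⟧ ≡ ⟦ z + w ⟧
  absorb z w = sym (⟦⟧-cong {b = ι ⟦ z ⟧ + w} (z /ℕ N) (trans (cong (_+ w) (lift z))
    (shuffle (ι ⟦ z ⟧) (z /ℕ N * + N) w)))
    where
    shuffle : ∀ a b c → a + b + c ≡ a + c + b
    shuffle = solve-∀

  ⟦+⟧ : ∀ {n} → (n<N : n < N) → ⟦ + n ⟧ ≡ fromℕ< n<N
  ⟦+⟧ n<N = ⟦ι⟧-cong 0ℤ (trans (cong +_ (sym (toℕ-fromℕ< n<N))) (sym (ℤ.+-identityʳ _)))

  toℕ⟦+⟧ : ∀ {n} → n < N → toℕ ⟦ + n ⟧ ≡ n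
  toℕ⟦+⟧ n<N = trans (cong toℕ (⟦+⟧ n<N)) (toℕ-fromℕ< n<N)

  ⟦N⟧ : ⟦ + N ⟧ ≡ ⟦ 0ℤ ⟧
  ⟦N⟧ = ⟦⟧-cong {b = 0ℤ} 1ℤ (once (+ N))
    where
    once : ∀ n → n ≡ 0ℤ + 1ℤ * n
    once = solve-∀

alt : {A : Set} → (ℕ → A) → (ℕ → A) → ℕ → A
alt x y zero          = x zero
alt x y (suc zero)    = y zero
alt x y (suc (suc i)) = alt (λ τ → x (suc τ)) (λ τ → y (suc τ)) i

alt-even : ∀ {A : Set} (x y : ℕ → A) τ → alt x y (τ ℕ.* 2) ≡ x τ
alt-even x y zero    = refl
alt-even x y (suc τ) = alt-even (λ τ → x (suc τ)) (λ τ → y (suc τ)) τ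

alt-odd : ∀ {A : Set} (x y : ℕ → A) τ → alt x y (suc (τ ℕ.* 2)) ≡ y τ
alt-odd x y zero    = refl
alt-odd x y (suc τ) = alt-odd (λ τ → x (suc τ)) (λ τ → y (suc τ)) τ

odd : ℕ → Bool
odd = alt (λ _ → false) (λ _ → true)

data Halved : ℕ → Set where
  twice : ∀ τ → Halved (τ ℕ.* 2)
  twice+1 : ∀ τ → Halved (suc (τ ℕ.* 2))

halve : ∀ i → Halved i
halve zero = twice zero
halve (suc i) with halve i
... | twice τ   = twice+1 τ
... | twice+1 τ = twice (suc τ)

*2-< : ∀ {a b} → a < b → suc (a ℕ.* 2) < b ℕ.* 2
*2-< {a} a<b = ℕ.*-monoˡ-≤ 2 a<b

*2-cancel-< : ∀ {a b} → a ℕ.* 2 < b ℕ.* 2 → a < b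
*2-cancel-< {a} {b} = ℕ.*-cancelʳ-< 2 a b

pos*2 : ∀ c → + (c ℕ.* 2) ≡ + c + + c
pos*2 c = trans (ℤ.pos-* c 2) (double (+ c))
  where
  double : ∀ c → c * + 2 ≡ c + c
  double = solve-∀

pos-1+*2 : ∀ c → + suc (c ℕ.* 2) ≡ 1ℤ + (+ c + + c)
pos-1+*2 c = cong (λ z → 1ℤ + z) (pos*2 c)

-- C_n-factorizations of double complete graphs for even n.

-- The round-robin 1-factorization of the complete graph on Z_N ∪ {∞}, N = 2r′ + 1:
-- the f-th factor consists of {∞ , f} and of the pairs {f + c , f − c} for 1 ≤ c ≤ r′.
module RoundRobin (r′ : ℕ) where
  open Residue (r′ ℕ.* 2) public
  private module Z = Residue r′

  r : ℕ
  r = suc r′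

  -- The two ends of the c-th pair of the f-th factor. `Pᶜ` reads its index modulo r, which closes
  -- the zigzag ∞, f, f + 1, f - 1, f + 2, ... into a Hamiltonian cycle on the N + 1 = 2r points.
  P Q Pᶜ : Fin N → ℕ → Maybe (Fin N)
  P f zero    = nothing
  P f (suc c) = just ⟦ ι f + + suc c ⟧
  Q f c = just ⟦ ι f - + c ⟧
  Pᶜ f c = P f (toℕ Z.⟦ + c ⟧)

  +N : + N ≡ 1ℤ + (+ r′ + + r′)
  +N = pos-1+*2 r′

  factor-covers : ∀ f x → ∃ λ c → c < r × (P f c ≡ x ⊎ Q f c ≡ x)
  factor-covers f nothing  = 0 , z<s , inj₁ refl
  factor-covers f (just a) = go (toℕ D) refl
    where
    D = ⟦ ι a - ι f ⟧
    k = (ι a - ι f) /ℕ N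
    diff : ∀ c → toℕ D ≡ c → ι a - ι f ≡ + c + k * + N
    diff c e = trans (lift _) (cong (λ c → + c + k * + N) e)
    plus : ∀ a f d k n → a - f ≡ d + k * n → f + d ≡ a + - k * n
    plus a f d k n e = trans (l a f d) (trans (cong (λ z → d - z + a) e) (m a d k n))
      where
      l : ∀ a f d → f + d ≡ d - (a - f) + a
      l = solve-∀
      m : ∀ a d k n → d - (d + k * n) + a ≡ a + - k * n
      m = solve-∀
    minus : ∀ f c → f - c ≡ f + - c
    minus = solve-∀
    wrap : ∀ c d → c ℕ.+ d ≡ N → toℕ D ≡ d → ι f - + c ≡ ι a + (- k - 1ℤ) * + N
    wrap c d c+d e = trans (l (ι f) (+ c) (+ d)) (trans (cong₂ _-_
      (plus (ι a) (ι f) (+ d) k (+ N) (diff d e)) (trans (sym (ℤ.pos-+ c d)) (cong +_ c+d)))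
      (m (ι a) k (+ N)))
      where
      l : ∀ f c d → f - c ≡ f + d - (c + d)
      l = solve-∀
      m : ∀ a k n → a + - k * n - n ≡ a + (- k - 1ℤ) * n
      m = solve-∀
    go : ∀ d → toℕ D ≡ d → ∃ λ c → c < r × (P f c ≡ just a ⊎ Q f c ≡ just a)
    go zero e = 0 , z<s , inj₂ (cong just (⟦ι⟧-cong (- k) (trans (minus (ι f) 0ℤ)
      (plus (ι a) (ι f) 0ℤ k (+ N) (diff 0 e)))))
    go (suc c) e with suc c ℕ.≤? r′
    ... | yes c<r′ = suc c , s≤s c<r′ , inj₁ (cong just (⟦ι⟧-cong (- k)
      (plus (ι a) (ι f) (+ suc c) k (+ N) (diff (suc c) e))))
    -- A difference d above r′ is -(N - d) with N - d ≤ r′, so the point lies on the `Q` side.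
    ... | no  c≮r′ = N ℕ.∸ suc c , s≤s small ,
      inj₂ (cong just (⟦ι⟧-cong (- k - 1ℤ) (wrap (N ℕ.∸ suc c) (suc c)
        (ℕ.m∸n+n≡m (ℕ.<⇒≤ (subst (_< N) e (toℕ<n D)))) e)))
      where
      small : N ℕ.∸ suc c ≤ r′
      small = ℕ.≤-trans (ℕ.∸-monoʳ-≤ N (ℕ.≰⇒> c≮r′)) (ℕ.≤-reflexive
        (trans (cong (ℕ._∸ r′) (trans (ℕ.*-comm r′ 2) (cong (r′ ℕ.+_) (ℕ.+-identityʳ r′))))
          (ℕ.m+n∸n≡m r′ r′)))

  even-difference : ∀ (a b : Fin N) k c → ι a - ι b ≡ + (suc c ℕ.* 2) + k * + N →
                    P ⟦ ι b + + suc c ⟧ (suc c) ≡ just a × Q ⟦ ι b + + suc c ⟧ (suc c) ≡ just b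
  even-difference a b k c e =
    cong just (trans (absorb (ι b + + suc c) (+ suc c)) (⟦ι⟧-cong (- k) (trans (l (ι a) (ι b) (+ suc c))
      (trans (cong (λ z → (+ suc c + + suc c) - z + ι a) (trans e (cong (_+ k * + N) (pos*2 (suc c)))))
        (m (+ suc c) (ι a) k (+ N))))))
    , cong just (trans (absorb (ι b + + suc c) (- + suc c)) (⟦ι⟧-cong 0ℤ (cancel (ι b) (+ suc c) (+ N))))
    where
    l : ∀ a b c → b + c + c ≡ (c + c) - (a - b) + a
    l = solve-∀
    m : ∀ c a k n → (c + c) - (c + c + k * n) + a ≡ a + - k * n
    m = solve-∀
    cancel : ∀ b c n → b + c - c ≡ b + 0ℤ * n
    cancel = solve-∀

  -- Since N is odd, one of a - b and b - a has an even representative. Half of it leads to the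
  -- midpoint f of a and b, which names their factor.
  pairs : ∀ x y → x ≢ y → ∃ λ f → ∃ λ c → c < r × Same (P f c) (Q f c) x y
  pairs nothing  nothing  x≢y = ⊥-elim (x≢y refl)
  pairs nothing  (just b) x≢y = b , 0 , z<s , inj₁ (refl , cong just (⟦ι⟧-cong 0ℤ refl))
  pairs (just a) nothing  x≢y = a , 0 , z<s , inj₂ (refl , cong just (⟦ι⟧-cong 0ℤ refl))
  pairs (just a) (just b) x≢y = go (toℕ D) (halve (toℕ D)) refl
    where
    D = ⟦ ι a - ι b ⟧
    k = (ι a - ι b) /ℕ N
    diff : ∀ {c} → c ≡ toℕ D → ι a - ι b ≡ + c + k * + N
    diff refl = lift _
    r′-bound : ∀ c → c ℕ.* 2 < N → c < r
    r′-bound c lt = s≤s (ℕ.*-cancelʳ-≤ _ _ 2 (ℕ.s≤s⁻¹ lt))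
    go : ∀ d → Halved d → d ≡ toℕ D → ∃ λ f → ∃ λ c → c < r × Same (P f c) (Q f c) (just a) (just b)
    go _ (twice zero) e = ⊥-elim (x≢y (cong just (trans (sym (⟦ι⟧ a))
      (⟦ι⟧-cong k (trans (l (ι a) (ι b)) (trans (cong (_+ ι b) (diff {0} e)) (m (ι b) k (+ N))))))))
      where
      l : ∀ a b → a ≡ a - b + b
      l = solve-∀
      m : ∀ b k n → 0ℤ + k * n + b ≡ b + k * n
      m = solve-∀
    go _ (twice (suc c)) e = _ , suc c , r′-bound (suc c) (subst (_< N) (sym e) (toℕ<n D)) , inj₁
      (even-difference a b k c (diff e))
    go _ (twice+1 c) e = _ , suc c′ , s≤s c′<r′ , inj₂ (even-difference b a (- k - 1ℤ) c′ flip)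
      where
      c<r′ : c < r′
      c<r′ = *2-cancel-< (ℕ.s<s⁻¹ (subst (_< N) (sym e) (toℕ<n D)))
      c′ = r′ ℕ.∸ suc c
      c′+c : suc c′ ℕ.+ c ≡ r′
      c′+c = trans (sym (ℕ.+-suc c′ c)) (ℕ.m∸n+n≡m c<r′)
      c′<r′ : c′ < r′
      c′<r′ = ℕ.≤-trans (ℕ.m≤m+n (suc c′) c) (ℕ.≤-reflexive c′+c)
      flip : ι b - ι a ≡ + (suc c′ ℕ.* 2) + (- k - 1ℤ) * + N
      flip = trans (l (ι a) (ι b)) (trans (cong -_ (trans (diff e) (cong (_+ k * + N) (pos-1+*2 c))))
        (trans (m (+ c) (+ suc c′) k (+ N) (+ r′) (trans (sym (ℤ.pos-+ (suc c′) c)) (cong +_ c′+c)) +N)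
          (cong (_+ (- k - 1ℤ) * + N) (sym (pos*2 (suc c′))))))
        where
        l : ∀ a b → b - a ≡ - (a - b)
        l = solve-∀
        m : ∀ c d k n r → d + c ≡ r → n ≡ 1ℤ + (r + r) → - (1ℤ + (c + c) + k * n) ≡ d + d + (- k - 1ℤ) * n
        m c d k n r refl refl = m′ c d k
          where
          m′ : ∀ c d k → - (1ℤ + (c + c) + k * (1ℤ + (d + c + (d + c)))) ≡ d + d + (- k - 1ℤ) *
            (1ℤ + (d + c + (d + c)))
          m′ = solve-∀

  Pᶜ-< : ∀ f {c} → c < r → Pᶜ f c ≡ P f c
  Pᶜ-< f c<r = cong (P f) (Z.toℕ⟦+⟧ c<r)

  Pᶜ-r : ∀ f → Pᶜ f r ≡ nothing
  Pᶜ-r f = cong (P f) (trans (cong toℕ Z.⟦N⟧) (Z.toℕ⟦+⟧ z<s))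

  -- The sums of the pairs {f − τ , f + τ + 1} are 2f + 1 = 2 (f + r), so that
  -- they form the (f + r)-th factor.
  links : ∀ x y → x ≢ y → ∃ λ f → ∃ λ τ → τ < r × Same (Q f τ) (Pᶜ f (suc τ)) x y
  links x y x≢y with pairs x y x≢y
  ... | f , c , c<r , s = ⟦ ι f - + r ⟧ , r′ ℕ.∸ c , s≤s (ℕ.m∸n≤m r′ c) , go c c<r s
    where
    f₁ = ⟦ ι f - + r ⟧
    Q-shift : ∀ c → c < r → Q f₁ (r′ ℕ.∸ c) ≡ just ⟦ ι f + + c ⟧
    Q-shift c c<r = cong just (trans (absorb (ι f - + r) (- + (r′ ℕ.∸ c)))
      (⟦⟧-cong -1ℤ (m (ι f) (+ c) (+ (r′ ℕ.∸ c)) (+ N) (+ r′)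
        (trans (sym (ℤ.pos-+ (r′ ℕ.∸ c) c)) (cong +_ (ℕ.m∸n+n≡m (ℕ.s≤s⁻¹ c<r)))) +N)))
      where
      m : ∀ f c d n r′ → d + c ≡ r′ → n ≡ 1ℤ + (r′ + r′) → f - (1ℤ + r′) + - d ≡ f + c + -1ℤ * n
      m f c d n r′ refl refl = m′ f c d
        where
        m′ : ∀ f c d → f - (1ℤ + (d + c)) + - d ≡ f + c + -1ℤ * (1ℤ + (d + c + (d + c)))
        m′ = solve-∀
    go : ∀ c′ → c′ < r → Same (P f c′) (Q f c′) x y → Same (Q f₁ (r′ ℕ.∸ c′)) (Pᶜ f₁ (suc (r′ ℕ.∸ c′))) x y
    -- The pair {∞, f} is the closing edge of the zigzag of f₁ = f - r: its last point f₁ - r′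
    -- equals f modulo 2r′ + 1.
    go zero c<r s = Same-flip (subst₂ (λ p q → Same p q x y) (sym (Pᶜ-r f₁))
      (trans (cong just (cong ⟦_⟧ (m (ι f)))) (sym (Q-shift 0 z<s))) s)
      where
      m : ∀ f → f - 0ℤ ≡ f + 0ℤ
      m = solve-∀
    go (suc c) c<r s = Same-resp (Q-shift (suc c) c<r) (trans (Pᶜ-< f₁ (s≤s small)) P-shift) s
      where
      d = r′ ℕ.∸ suc c
      d+c : d ℕ.+ suc c ≡ r′
      d+c = ℕ.m∸n+n≡m (ℕ.s≤s⁻¹ c<r)
      small : suc d ≤ r′
      small = ℕ.≤-trans (ℕ.≤-trans (ℕ.≤-reflexive (sym (ℕ.+-comm d 1))) (ℕ.+-monoʳ-≤ d (s≤s z≤n)))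
        (ℕ.≤-reflexive d+c)
      P-shift : P f₁ (suc d) ≡ Q f (suc c)
      P-shift = cong just (trans (absorb (ι f - + r) (+ suc d)) (cong ⟦_⟧
        (m (ι f) (+ suc c) (+ d) (+ r′) (trans (sym (ℤ.pos-+ d (suc c))) (cong +_ d+c)))))
        where
        m : ∀ f c d r → d + c ≡ r → f - (1ℤ + r) + (1ℤ + d) ≡ f - c
        m f c d r refl = m′ f c d
          where
          m′ : ∀ f c d → f - (1ℤ + (d + c)) + (1ℤ + d) ≡ f - c
          m′ = solve-∀

-- A C_n-factorization of the double complete graph on G, n = n′ + 1, with "exactly" weakened to
-- "at least"; the two uses of an edge are distinguished by the parity of the step.
record Wheel (n′ : ℕ) (G D C : Set) : Set where
  open Residue n′
  field
    ω      : D → C → Fin N → G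
    covers : ∀ d x → ∃ λ c → ∃ λ i → ω d c i ≡ x
    joins  : ∀ x y → x ≢ y → ∀ ℓ → ∃ λ d → ∃ λ c → ∃ λ i →
             odd (toℕ i) ≡ ℓ × Same (ω d c i) (ω d c ⟦ ι i + 1ℤ ⟧) x y

-- Labelling by parity splits the double cover into two single ones: the steps from `ev` to `od`
-- have to reach every edge, and so do the steps from `od` to the next `ev`.
module _ (l′ : ℕ) {G D C : Set} (ev od : D → C → ℕ → G)
         (closed : ∀ d c → ev d c (suc l′) ≡ ev d c 0)
         (covers : ∀ d x → ∃ λ c → ∃ λ τ → τ < suc l′ × (ev d c τ ≡ x ⊎ od d c τ ≡ x))
         (evens  : ∀ x y → x ≢ y → ∃ λ d → ∃ λ c → ∃ λ τ → τ < suc l′ × Same (ev d c τ) (od d c τ) x y)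
         (odds   : ∀ x y → x ≢ y → ∃ λ d → ∃ λ c → ∃ λ τ → τ < suc l′ × Same (od d c τ)
           (ev d c (suc τ)) x y) where
  private
    open Residue (suc (l′ ℕ.* 2))

    ω′ : D → C → Fin N → G
    ω′ d c i = alt (ev d c) (od d c) (toℕ i)

    at : ∀ d c {i} → i < N → ω′ d c ⟦ + i ⟧ ≡ alt (ev d c) (od d c) i
    at d c i<N = cong (alt (ev d c) (od d c)) (toℕ⟦+⟧ i<N)

    at-even : ∀ d c {τ} → τ < suc l′ → ω′ d c ⟦ + (τ ℕ.* 2) ⟧ ≡ ev d c τ
    at-even d c {τ} τ<l = trans (at d c (ℕ.<⇒≤ (*2-< τ<l))) (alt-even (ev d c) (od d c) τ)

    at-odd : ∀ d c {τ} → τ < suc l′ → ω′ d c ⟦ + suc (τ ℕ.* 2) ⟧ ≡ od d c τ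
    at-odd d c {τ} τ<l = trans (at d c (*2-< τ<l)) (alt-odd (ev d c) (od d c) τ)

    at-next : ∀ d c {τ} → τ < suc l′ → ω′ d c ⟦ + (suc τ ℕ.* 2) ⟧ ≡ ev d c (suc τ)
    at-next d c {τ} τ<l with suc τ ℕ.<? suc l′
    ... | yes lt = at-even d c lt
    ... | no ¬lt with ℕ.≤-antisym (ℕ.s≤s⁻¹ τ<l) (ℕ.s≤s⁻¹ (ℕ.≮⇒≥ ¬lt))
    ...   | refl = trans (cong (ω′ d c) ⟦N⟧) (trans (at-even d c z<s) (sym (closed d c)))

    step : ∀ d c i → ω′ d c ⟦ ι ⟦ + i ⟧ + 1ℤ ⟧ ≡ ω′ d c ⟦ + suc i ⟧
    step d c i = cong (ω′ d c) (trans (absorb (+ i) 1ℤ) (cong ⟦_⟧ (ℤ.+-comm (+ i) 1ℤ)))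

    covers′ : ∀ d x → ∃ λ c → ∃ λ i → ω′ d c i ≡ x
    covers′ d x with covers d x
    ... | c , τ , τ<l , inj₁ e = c , ⟦ + (τ ℕ.* 2) ⟧ , trans (at-even d c τ<l) e
    ... | c , τ , τ<l , inj₂ e = c , ⟦ + suc (τ ℕ.* 2) ⟧ , trans (at-odd d c τ<l) e

    joins′ : ∀ x y → x ≢ y → ∀ ℓ → ∃ λ d → ∃ λ c → ∃ λ i →
             odd (toℕ i) ≡ ℓ × Same (ω′ d c i) (ω′ d c ⟦ ι i + 1ℤ ⟧) x y
    joins′ x y x≢y false with evens x y x≢y
    ... | d , c , τ , τ<l , s = d , c , ⟦ + (τ ℕ.* 2) ⟧ ,
      trans (cong odd (toℕ⟦+⟧ (ℕ.<⇒≤ (*2-< τ<l)))) (alt-even _ _ τ) ,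
      Same-resp (at-even d c τ<l) (trans (step d c (τ ℕ.* 2)) (at-odd d c τ<l)) s
    joins′ x y x≢y true with odds x y x≢y
    ... | d , c , τ , τ<l , s = d , c , ⟦ + suc (τ ℕ.* 2) ⟧ ,
      trans (cong odd (toℕ⟦+⟧ (*2-< τ<l))) (alt-odd _ _ τ) ,
      Same-resp (at-odd d c τ<l) (trans (step d c (suc (τ ℕ.* 2))) (at-next d c τ<l)) s

  alternating-wheel : Wheel (suc (l′ ℕ.* 2)) G D C
  alternating-wheel = record { ω = ω′ ; covers = covers′ ; joins = joins′ }

-- The 2-fold C_{2l}-factorization of the complete graph on 2rl vertices, for l = l′ + 1, r = r′ + 1.
-- The vertices form 2r parts of size l.  Round-robin factors of the parts other than the 0-th
-- give pairs of parts, each carrying l Hamiltonian cycles of 2K_{l,l}; within the pairs of the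
-- 0-th factor one uses the 2l − 1 zigzag Hamiltonian cycles of 2K_{2l}.
module EvenCycles (l′ r′ : ℕ) where
  private
    module R = RoundRobin r′
    module L = RoundRobin l′
    module Z = Residue l′

  Part Point : Set
  Part  = Maybe (Fin R.N)
  Point = Part × Fin (suc l′)

  -- Its size is 2r′l + (2l - 1) = 2rl - 1, the g - 1 factors that the count demands for each hole.
  Index : Set
  Index = (Fin (r′ ℕ.* 2) × Fin (suc l′)) ⊎ Fin L.N

  private
    number : Maybe (Fin L.N) → ℕ
    number nothing  = 0
    number (just i) = suc (toℕ i)

    number-onto : ∀ {i} → i < suc L.N → ∃ λ x → number x ≡ i
    number-onto {zero}  i<N = nothing , refl
    number-onto {suc i} i<N = just (fromℕ< (ℕ.s<s⁻¹ i<N)) , cong suc (toℕ-fromℕ< (ℕ.s<s⁻¹ i<N))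

    split : Maybe (Fin L.N) → Bool × Fin (suc l′)
    split x = alt (λ τ → true , Z.⟦ + τ ⟧) (λ τ → false , Z.⟦ + τ ⟧) (number x)

    split-onto : ∀ b t → ∃ λ x → split x ≡ (b , t)
    split-onto true t with number-onto (ℕ.<⇒≤ (*2-< (toℕ<n t)))
    ... | x , e = x , trans (cong (alt _ _) e) (trans (alt-even _ _ (toℕ t)) (cong (true ,_) (Z.⟦ι⟧ t)))
    split-onto false t with number-onto (*2-< (toℕ<n t))
    ... | x , e = x , trans (cong (alt _ _) e) (trans (alt-odd _ _ (toℕ t)) (cong (false ,_) (Z.⟦ι⟧ t)))

    place : Fin R.r → Bool × Fin (suc l′) → Point
    place c (true  , t) = R.P fz (toℕ c) , t
    place c (false , t) = R.Q fz (toℕ c) , t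

    -- For fixed δ, the coordinate in the second part exceeds that in the first by δ on even steps
    -- and by δ - 1 on odd steps. As δ runs through Z_l, each parity therefore runs through K_{l,l}
    -- once.
    ev od : Index → Fin R.r → ℕ → Point
    ev (inj₁ (f , δ)) c τ = R.P (fs f) (toℕ c) , Z.⟦ + τ ⟧
    ev (inj₂ j)       c τ = place c (split (L.Pᶜ j τ))
    od (inj₁ (f , δ)) c τ = R.Q (fs f) (toℕ c) , Z.⟦ + τ + ι δ ⟧
    od (inj₂ j)       c τ = place c (split (L.Q j τ))

    closed : ∀ d c → ev d c (suc l′) ≡ ev d c 0
    closed (inj₁ (f , δ)) c = cong (R.P (fs f) (toℕ c) ,_) Z.⟦N⟧
    closed (inj₂ j)       c = cong (λ x → place c (split x)) (trans (L.Pᶜ-r j) (sym (L.Pᶜ-< j z<s)))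

    toℕ-part : ∀ {A : Set} (F : ℕ → A) {c} (c<r : c < R.r) → F (toℕ (fromℕ< c<r)) ≡ F c
    toℕ-part F c<r = cong F (toℕ-fromℕ< c<r)

    in-pair : ∀ p → ∃ λ c → ∃ λ b → ∀ t → place c (b , t) ≡ (p , t)
    in-pair p with R.factor-covers fz p
    ... | c , c<r , inj₁ e = fromℕ< c<r , true  , λ t → cong (_, t) (trans (toℕ-part (R.P fz) c<r) e)
    ... | c , c<r , inj₂ e = fromℕ< c<r , false , λ t → cong (_, t) (trans (toℕ-part (R.Q fz) c<r) e)

    covers : ∀ d x → ∃ λ c → ∃ λ τ → τ < suc l′ × (ev d c τ ≡ x ⊎ od d c τ ≡ x)
    covers (inj₁ (f , δ)) (p , t) with R.factor-covers (fs f) p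
    ... | c , c<r , inj₁ e = fromℕ< c<r , toℕ t , toℕ<n t ,
      inj₁ (cong₂ _,_ (trans (toℕ-part (R.P (fs f)) c<r) e) (Z.⟦ι⟧ t))
    ... | c , c<r , inj₂ e = fromℕ< c<r , toℕ Z.⟦ ι t - ι δ ⟧ , toℕ<n Z.⟦ ι t - ι δ ⟧ ,
      inj₂ (cong₂ _,_ (trans (toℕ-part (R.Q (fs f)) c<r) e)
        (trans (Z.absorb (ι t - ι δ) (ι δ)) (Z.⟦ι⟧-cong 0ℤ (cancel (ι t) (ι δ) (+ suc l′)))))
      where
      cancel : ∀ t d n → t - d + d ≡ t + 0ℤ * n
      cancel = solve-∀
    covers (inj₂ j) (p , t) with in-pair p
    ... | c , b , at with split-onto b t
    ...   | x , e with L.factor-covers j x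
    ...     | τ , τ<l , inj₁ e′ = c , τ , τ<l , inj₁ (trans (cong (λ x → place c (split x))
      (trans (L.Pᶜ-< j τ<l) e′)) (trans (cong (place c) e) (at t)))
    ...     | τ , τ<l , inj₂ e′ = c , τ , τ<l , inj₂ (trans (cong (λ x → place c (split x)) e′)
      (trans (cong (place c) e) (at t)))

    -- The edges `across` belong to pairs of parts in a factor other than the 0-th; those `inside` a
    -- pair of the 0-th factor include all edges within a single part.
    data Position : Point → Point → Set where
      across : ∀ f (c : Fin R.r) {p q s t} → R.P (fs f) (toℕ c) ≡ p → R.Q (fs f) (toℕ c) ≡ q → Position
        (p , s) (q , t)
      inside : ∀ c x y {v w} → x ≢ y → place c (split x) ≡ v → place c (split y) ≡ w → Position v w

    inside′ : ∀ c b b′ s t {v w} → (b , s) ≢ (b′ , t) → place c (b , s) ≡ v → place c (b′ , t) ≡ w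
      → Position v w
    inside′ c b b′ s t ne e e′ with split-onto b s | split-onto b′ t
    ... | x , ex | y , ey = inside c x y (λ x≡y → ne (trans (sym ex) (trans (cong split x≡y) ey)))
      (trans (cong (place c) ex) e) (trans (cong (place c) ey) e′)

    position : ∀ v w → v ≢ w → Position v w ⊎ Position w v
    position (p , s) (q , t) v≢w with Maybe.≡-dec _≟F_ p q
    ... | yes refl with in-pair p
    ...   | c , b , at = inj₁ (inside′ c b b s t (λ e → v≢w (cong (λ z → p , proj₂ z) e)) (at s) (at t))
    position (p , s) (q , t) v≢w | no p≢q with R.pairs p q p≢q
    ... | fz , c , c<r , inj₁ (e , e′) = inj₁ (inside′ (fromℕ< c<r) true false s t (λ ())
          (cong (_, s) (trans (toℕ-part (R.P fz) c<r) e)) (cong (_, t) (trans (toℕ-part (R.Q fz) c<r) e′)))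
    ... | fz , c , c<r , inj₂ (e , e′) = inj₂ (inside′ (fromℕ< c<r) true false t s (λ ())
          (cong (_, t) (trans (toℕ-part (R.P fz) c<r) e)) (cong (_, s) (trans (toℕ-part (R.Q fz) c<r) e′)))
    ... | fs f , c , c<r , inj₁ (e , e′) = inj₁ (across f (fromℕ< c<r)
          (trans (toℕ-part (R.P (fs f)) c<r) e) (trans (toℕ-part (R.Q (fs f)) c<r) e′))
    ... | fs f , c , c<r , inj₂ (e , e′) = inj₂ (across f (fromℕ< c<r)
          (trans (toℕ-part (R.P (fs f)) c<r) e) (trans (toℕ-part (R.Q (fs f)) c<r) e′))

    even-step : ∀ {v w} → Position v w → ∃ λ d → ∃ λ c → ∃ λ τ → τ < suc l′ × Same (ev d c τ) (od d c τ) v w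
    even-step (across f c {s = s} {t} e e′) = inj₁ (f , Z.⟦ ι t - ι s ⟧) , c , toℕ s , toℕ<n s ,
      inj₁ (cong₂ _,_ e (Z.⟦ι⟧ s) , cong₂ _,_ e′ (trans (cong Z.⟦_⟧ (ℤ.+-comm (ι s) (ι Z.⟦ ι t - ι s ⟧)))
        (trans (Z.absorb (ι t - ι s) (ι s)) (Z.⟦ι⟧-cong 0ℤ (cancel (ι t) (ι s) (+ suc l′))))))
      where
      cancel : ∀ t d n → t - d + d ≡ t + 0ℤ * n
      cancel = solve-∀
    even-step (inside c x y x≢y e e′) with L.pairs x y x≢y
    ... | j , τ , τ<l , s = inj₂ j , c , τ , τ<l , subst₂ (Same _ _) e e′
      (Same-map (λ x → place c (split x)) (Same-resp (L.Pᶜ-< j τ<l) refl s))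

    odd-step : ∀ {v w} → Position v w → ∃ λ d → ∃ λ c → ∃ λ τ → τ < suc l′ × Same (od d c τ)
      (ev d c (suc τ)) v w
    odd-step (across f c {s = s} {t} e e′) = inj₁ (f , Z.⟦ ι t - ι τ ⟧) , c , toℕ τ , toℕ<n τ ,
      inj₂ (cong₂ _,_ e′ (trans (cong Z.⟦_⟧ (ℤ.+-comm (ι τ) (ι Z.⟦ ι t - ι τ ⟧)))
        (trans (Z.absorb (ι t - ι τ) (ι τ)) (Z.⟦ι⟧-cong 0ℤ (cancel (ι t) (ι τ) (+ suc l′))))) ,
        cong₂ _,_ e (trans (cong Z.⟦_⟧ (ℤ.+-comm 1ℤ (ι τ))) (trans (Z.absorb (ι s - 1ℤ) 1ℤ)
          (Z.⟦ι⟧-cong 0ℤ (cancel (ι s) 1ℤ (+ suc l′))))))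
      where
      τ = Z.⟦ ι s - 1ℤ ⟧
      cancel : ∀ t d n → t - d + d ≡ t + 0ℤ * n
      cancel = solve-∀
    odd-step (inside c x y x≢y e e′) with L.links x y x≢y
    ... | j , τ , τ<l , s = inj₂ j , c , τ , τ<l , subst₂ (Same _ _) e e′
      (Same-map (λ x → place c (split x)) s)

    symmetric : {D C : Set} (p q : D → C → ℕ → Point) →
                (∀ {v w} → Position v w → ∃ λ d → ∃ λ c → ∃ λ τ → τ < suc l′ × Same (p d c τ)
                  (q d c τ) v w) →
                ∀ v w → v ≢ w → ∃ λ d → ∃ λ c → ∃ λ τ → τ < suc l′ × Same (p d c τ) (q d c τ) v w
    symmetric p q F v w v≢w with position v w v≢w
    ... | inj₁ pos = F pos
    ... | inj₂ pos = let d , c , τ , τ<l , s = F pos in d , c , τ , τ<l , Same-sym s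

  wheel : Wheel (suc (l′ ℕ.* 2)) Point Index (Fin (suc r′))
  wheel = alternating-wheel l′ ev od closed covers
    (symmetric ev od even-step) (symmetric od (λ d c τ → ev d c (suc τ)) odd-step)

-- Lifting signed near factorizations along the wheel.

abstract
  walk : {A : Set} (m′ : ℕ) → (ℕ → ℕ → A) → ℕ → A
  walk m′ F q = F (q ℕ./ suc m′) (q ℕ.% suc m′)

  walk-at : ∀ {A : Set} {m′} (F : ℕ → ℕ → A) t {i} → i < suc m′ → walk m′ F (i ℕ.+ t ℕ.* suc m′) ≡ F t i
  walk-at {m′ = m′} F t {i} i<m = cong₂ F
    (trans (ℕ.+-distrib-/-∣ʳ i (ℕ.n∣m*n t)) (cong₂ ℕ._+_ (ℕ.m<n⇒m/n≡0 i<m) (ℕ.m*n/n≡m t (suc m′))))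
    (trans (ℕ.[m+kn]%n≡m%n i t (suc m′)) (ℕ.m<n⇒m%n≡m i<m))

walk-round : ∀ {A : Set} {m′} (F : ℕ → ℕ → A) t → walk m′ F (suc (m′ ℕ.+ t ℕ.* suc m′)) ≡ F (suc t) 0
walk-round F t = walk-at F (suc t) z<s

walk-< : ∀ {n m t i} → t < n → i < m → i ℕ.+ t ℕ.* m < n ℕ.* m
walk-< {n} {m} {t} t<n i<m = ℕ.≤-trans (ℕ.+-monoˡ-< (t ℕ.* m) i<m) (ℕ.*-monoˡ-≤ m t<n)

Dir : {U : Set} → Bool → U → U → U → U → Set
Dir true  p q a b = p ≡ a × q ≡ b
Dir false p q a b = q ≡ a × p ≡ b

-- Near m-cycle factors of 2K_U, m = 2h + 1: for every hole v the cycles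
-- a₀ b₀ a₁ b₁ … b_{h−1} a_h (one for each s : S) cover U ∖ {v}.  They are oriented so that
-- κ τ tells whether b_τ is a sink or a source, and κ h is the direction of a_h a₀; every
-- ordered pair is an arc.
record Near (h : ℕ) (U S : Set) : Set where
  field
    a b    : U → S → ℕ → U
    κ      : U → S → ℕ → Bool
    covers : ∀ v w → w ≢ v → ∃ λ s →
             (∃ λ τ → τ ≤ h × a v s τ ≡ w) ⊎ (∃ λ τ → τ < h × b v s τ ≡ w)

  Arc : U → S → U → U → Set
  Arc v s x y = (∃ λ τ → τ < h × (Dir (κ v s τ) (a v s τ) (b v s τ) x y ⊎ Dir (κ v s τ) (a v s (suc τ))
    (b v s τ) x y))
              ⊎ Dir (κ v s h) (a v s h) (a v s 0) x y

  field
    arcs   : ∀ x y → x ≢ y → ∃ λ v → ∃ λ s → Arc v s x y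

sgn : Bool → ℤ
sgn true  = 1ℤ
sgn false = -1ℤ

-- A step from wheel position i to i ± 1 runs along the wheel edge that starts at i or at i - 1;
-- this is the offset of that start, which also determines the label.
low : Bool → ℤ
low true  = 0ℤ
low false = -1ℤ

-- The lift of an m-cycle to U × G moves along a closed walk of the wheel, forwards or backwards
-- according to the orientation of the arcs of the cycle; these steps cancel in pairs except
-- for the last one, so that each round of the m-cycle advances by one step of the wheel.
module Lift {h n′ : ℕ} {U S G D C : Set} (near : Near h U S) (wheel : Wheel n′ G D C) where
  private
    open Near near
    module W = Wheel wheel
    open Residue n′
    n = suc n′
    m = suc (h ℕ.* 2)

    index : Bool → ℕ → ℤ → Fin n
    index χ t e = ⟦ sgn χ * + t + e ⟧

    abstract
      -- Multiplication by ±1 is its own inverse modulo n. Thus n rounds carry each vertex of the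
      -- m-cycle over all wheel positions.
      round : ∀ χ e i → ∃ λ t → t < n × index χ t e ≡ i
      round χ e i = toℕ T , toℕ<n T , trans (cong ⟦_⟧ (factor χ (ι T) e))
          (trans (absorb-sgn χ) (⟦ι⟧-cong 0ℤ (cancel χ (ι i) e (+ n))))
        where
        T : Fin n
        T = ⟦ sgn χ * (ι i - e) ⟧
        factor : ∀ χ t e → sgn χ * t + e ≡ sgn χ * (t + sgn χ * e)
        factor true  = l where
          l : ∀ t e → 1ℤ * t + e ≡ 1ℤ * (t + 1ℤ * e)
          l = solve-∀
        factor false = l where
          l : ∀ t e → -1ℤ * t + e ≡ -1ℤ * (t + -1ℤ * e)
          l = solve-∀
        absorb-sgn : ∀ χ → ⟦ sgn χ * (ι ⟦ sgn χ * (ι i - e) ⟧ + sgn χ * e) ⟧ ≡ ⟦ sgn χ *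
          (sgn χ * (ι i - e) + sgn χ * e) ⟧
        absorb-sgn χ with lift (sgn χ * (ι i - e))
        ... | eq = sym (⟦⟧-cong (sgn χ * k) (trans (cong (λ z → sgn χ * (z + sgn χ * e)) eq)
          (l (sgn χ) (ι ⟦ sgn χ * (ι i - e) ⟧) k (+ n) (sgn χ * e))))
          where
          k : ℤ
          k = (sgn χ * (ι i - e)) /ℕ n
          l : ∀ s a k n e → s * (a + k * n + e) ≡ s * (a + e) + s * k * n
          l = solve-∀
        cancel : ∀ χ i e n → sgn χ * (sgn χ * (i - e) + sgn χ * e) ≡ i + 0ℤ * n
        cancel true  = l where
          l : ∀ i e n → 1ℤ * (1ℤ * (i - e) + 1ℤ * e) ≡ i + 0ℤ * n
          l = solve-∀
        cancel false = l where
          l : ∀ i e n → -1ℤ * (-1ℤ * (i - e) + -1ℤ * e) ≡ i + 0ℤ * n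
          l = solve-∀

    module _ (v : U) (d : D) (s : S) (c : C) where
      χ = κ v s h

      -- In round t all the vertices a_τ lie over the position χt, and b_τ over a neighbour of it.
      -- The only net movement is on the arc from a_h to the a₀ of round t + 1.
      cell : ℕ → ℕ → U × G
      cell t = alt (λ τ → a v s τ , W.ω d c (index χ t 0ℤ)) (λ τ → b v s τ , W.ω d c
        (index χ t (sgn (κ v s τ))))

      label : ℕ → ℕ → Bool
      label t = alt (λ τ → odd (toℕ (index χ t (low (κ v s τ)))))
        (λ τ → odd (toℕ (index χ t (low (κ v s τ)))))

      cell-even : ∀ t τ → cell t (τ ℕ.* 2) ≡ (a v s τ , W.ω d c (index χ t 0ℤ))
      cell-even t = alt-even _ _

      cell-odd : ∀ t τ → cell t (suc (τ ℕ.* 2)) ≡ (b v s τ , W.ω d c (index χ t (sgn (κ v s τ))))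
      cell-odd t = alt-odd _ _

      even< : ∀ {τ} → τ ≤ h → τ ℕ.* 2 < m
      even< τ≤h = s≤s (ℕ.*-monoˡ-≤ 2 τ≤h)

      odd< : ∀ {τ} → τ < h → suc (τ ℕ.* 2) < m
      odd< τ<h = ℕ.<-trans (*2-< τ<h) (ℕ.n<1+n _)

      γ′ : ℕ → U × G
      γ′ = walk (h ℕ.* 2) cell

      lab′ : ℕ → Bool
      lab′ = walk (h ℕ.* 2) label

      closed′ : γ′ (n ℕ.* m) ≡ γ′ 0
      closed′ = trans (walk-at cell n z<s) (trans (cong (λ i → a v s 0 , W.ω d c i)
        (⟦⟧-cong {b = sgn χ * 0ℤ + 0ℤ} (sgn χ) (l (sgn χ) (+ n)))) (sym (walk-at cell 0 z<s)))
        where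
        l : ∀ s n → s * n + 0ℤ ≡ (s * 0ℤ + 0ℤ) + s * n
        l = solve-∀

      covers′ : ∀ x i → ((∃ λ τ → τ ≤ h × a v s τ ≡ x) ⊎ (∃ λ τ → τ < h × b v s τ ≡ x)) →
                ∃ λ q → q < n ℕ.* m × γ′ q ≡ (x , W.ω d c i)
      covers′ x i (inj₁ (τ , τ≤h , e)) with round χ 0ℤ i
      ... | t , t<n , eq = τ ℕ.* 2 ℕ.+ t ℕ.* m , walk-< {n} {m} {t} t<n (even< τ≤h) ,
        trans (walk-at cell t (even< τ≤h)) (trans (cell-even t τ) (cong₂ _,_ e (cong (W.ω d c) eq)))
      covers′ x i (inj₂ (τ , τ<h , e)) with round χ (sgn (κ v s τ)) i
      ... | t , t<n , eq = suc (τ ℕ.* 2) ℕ.+ t ℕ.* m , walk-< {n} {m} {t} t<n (odd< τ<h) ,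
        trans (walk-at cell t (odd< τ<h)) (trans (cell-odd t τ) (cong₂ _,_ e (cong (W.ω d c) eq)))

      directed : ∀ κ t i {p q x y : U} → index χ t (low κ) ≡ i → Dir κ p q x y →
                 Same (p , W.ω d c (index χ t 0ℤ)) (q , W.ω d c (index χ t (sgn κ))) (x , W.ω d c i)
                   (y , W.ω d c ⟦ ι i + 1ℤ ⟧)
      directed true  t i e (refl , refl) = inj₁ (cong (λ i → _ , W.ω d c i) e , cong (λ i → _ , W.ω d c i)
        (sym (trans (cong (λ i → ⟦ ι i + 1ℤ ⟧) (sym e)) (trans (absorb _ 1ℤ)
          (cong ⟦_⟧ (l (sgn χ * + t)))))))
        where
        l : ∀ z → z + 0ℤ + 1ℤ ≡ z + 1ℤ
        l = solve-∀
      directed false t i e (refl , refl) = inj₂ (cong (λ i → _ , W.ω d c i)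
        (sym (trans (cong (λ i → ⟦ ι i + 1ℤ ⟧) (sym e)) (trans (absorb _ 1ℤ)
          (cong ⟦_⟧ (l (sgn χ * + t)))))) , cong (λ i → _ , W.ω d c i) e)
        where
        l : ∀ z → z + -1ℤ + 1ℤ ≡ z + 0ℤ
        l = solve-∀

      edge : ∀ x y i → Arc v s x y → ∃ λ q → q < n ℕ.* m × lab′ q ≡ odd (toℕ i) ×
             Same (γ′ q) (γ′ (suc q)) (x , W.ω d c i) (y , W.ω d c ⟦ ι i + 1ℤ ⟧)
      edge x y i (inj₁ (τ , τ<h , inj₁ dir)) with round χ (low (κ v s τ)) i
      ... | t , t<n , eq = τ ℕ.* 2 ℕ.+ t ℕ.* m , walk-< {n} {m} {t} t<n (even< (ℕ.<⇒≤ τ<h)) ,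
        trans (walk-at label t (even< (ℕ.<⇒≤ τ<h))) (trans (alt-even _ _ τ) (cong (λ i → odd (toℕ i)) eq)) ,
        Same-resp (trans (walk-at cell t (even< (ℕ.<⇒≤ τ<h))) (cell-even t τ))
                  (trans (walk-at cell t (odd< τ<h)) (cell-odd t τ)) (directed (κ v s τ) t i eq dir)
      edge x y i (inj₁ (τ , τ<h , inj₂ dir)) with round χ (low (κ v s τ)) i
      ... | t , t<n , eq = suc (τ ℕ.* 2) ℕ.+ t ℕ.* m , walk-< {n} {m} {t} t<n (odd< τ<h) ,
        trans (walk-at label t (odd< τ<h)) (trans (alt-odd _ _ τ) (cong (λ i → odd (toℕ i)) eq)) ,
        Same-flip (Same-resp (trans (walk-at cell t (even< τ<h)) (cell-even t (suc τ)))
                             (trans (walk-at cell t (odd< τ<h)) (cell-odd t τ))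
                               (directed (κ v s τ) t i eq dir))
      edge x y i (inj₂ dir) with round χ (low χ) i
      ... | t , t<n , eq = h ℕ.* 2 ℕ.+ t ℕ.* m , walk-< {n} {m} {t} t<n (even< ℕ.≤-refl) ,
        trans (walk-at label t (even< ℕ.≤-refl)) (trans (alt-even _ _ h) (cong (λ i → odd (toℕ i)) eq)) ,
        Same-resp (trans (walk-at cell t (even< ℕ.≤-refl)) (cell-even t h))
                  (trans (walk-round cell t) (cong (λ i → a v s 0 , W.ω d c ⟦ i ⟧) (l (sgn χ) (+ t))))
                    (directed χ t i eq dir)
        where
        l : ∀ s t → s * (1ℤ + t) + 0ℤ ≡ s * t + s
        l = solve-∀

    joins : ∀ a b x y → a ≢ b → x ≢ y → ∀ ℓ → ∃ λ v → ∃ λ d → ∃ λ sc → ∃ λ q →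
            q < n ℕ.* m × lab′ v d (proj₁ sc) (proj₂ sc) q ≡ ℓ ×
            Same (γ′ v d (proj₁ sc) (proj₂ sc) q) (γ′ v d (proj₁ sc) (proj₂ sc) (suc q)) (a , x) (b , y)
    joins a b x y a≢b x≢y ℓ with W.joins x y x≢y ℓ
    ... | d , c , i , par , inj₁ (refl , refl) with arcs a b a≢b
    ...   | v , s , arc with edge v d s c a b i arc
    ...     | q , q<k , l , same = v , d , (s , c) , q , q<k , trans l par , same
    -- Here the wheel runs from y to x, so the arc from b to a is lifted.
    joins a b x y a≢b x≢y ℓ | d , c , i , par , inj₂ (refl , refl) with arcs b a (λ e → a≢b (sym e))
    ...   | v , s , arc with edge v d s c b a i arc
    ...     | q , q<k , l , same = v , d , (s , c) , q , q<k , trans l par , Same-sym same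

  lifted : Scheme U G D (S × C) (suc n′ ℕ.* suc (h ℕ.* 2))
  lifted = record
    { γ      = λ v d (s , c) → γ′ v d s c
    ; lab    = λ v d (s , c) → lab′ v d s c
    ; closed = λ v d (s , c) → closed′ v d s c
    ; covers = λ v d w x w≢v →
        let s , p = covers v w w≢v
            c , i , e = W.covers d x
            q , q<k , e′ = covers′ v d s c w i p
        in (s , c) , q , q<k , trans e′ (cong (w ,_) e)
    ; joins  = joins
    }

-- Signed near m-cycle factorizations on m + 1 and on 2m + 1 points.

-- m + 1 points Z_m ∪ {∞}: the cycle of the hole j is ∞, j + 1, j − 1, j + 2, j − 2, …, and that of
-- the hole ∞ is 0, 1, 2, ….  In the former all arcs point from j + t to j − t or j − t + 1, except
-- those whose difference is ±1 or which contain ∞; their directions are chosen by parity.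
module NearOne (h′ : ℕ) where
  private
    h = suc h′
    open RoundRobin h

    U : Set
    U = Maybe (Fin N)

    a b : U → ⊤ → ℕ → U
    a nothing  _ τ = just ⟦ + (τ ℕ.* 2) ⟧
    a (just j) _ τ = Pᶜ j (suc τ)
    b nothing  _ τ = just ⟦ + suc (τ ℕ.* 2) ⟧
    b (just j) _ τ = Q j (suc τ)

    -- For τ < h′ the arcs have the differences 2, 3, ..., 2h - 1, all residues modulo 2h + 1 other
    -- than 0 and ±1. The cycle of the hole ∞ joins x to x + 1 for even x and x + 1 to x for odd x;
    -- the value at h′, with x = j + h, supplies the opposite direction. This also directs the edge
    -- between x + 1 and ∞, and the value at h, with x = j, supplies its reverse.
    κ : U → ⊤ → ℕ → Bool
    κ nothing  _ τ = true
    κ (just j) _ τ with τ ℕ.<? h′ | τ ℕ.≟ h′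
    ... | yes _ | _     = true
    ... | no _  | yes _ = odd (toℕ ⟦ ι j + + h ⟧)
    ... | no _  | no _  = not (odd (toℕ j))

    κ-< : ∀ j {τ} → τ < h′ → κ (just j) tt τ ≡ true
    κ-< j {τ} τ<h′ with τ ℕ.<? h′ | τ ℕ.≟ h′
    ... | yes _ | _ = refl
    ... | no ¬p | _ = ⊥-elim (¬p τ<h′)

    κ-h′ : ∀ j → κ (just j) tt h′ ≡ odd (toℕ ⟦ ι j + + h ⟧)
    κ-h′ j with h′ ℕ.<? h′ | h′ ℕ.≟ h′
    ... | yes p | _     = ⊥-elim (ℕ.<-irrefl refl p)
    ... | no _  | yes _ = refl
    ... | no _  | no ¬p = ⊥-elim (¬p refl)

    κ-h : ∀ j → κ (just j) tt h ≡ not (odd (toℕ j))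
    κ-h j with h ℕ.<? h′ | h ℕ.≟ h′
    ... | yes p | _     = ⊥-elim (ℕ.<⇒≱ p (ℕ.n≤1+n h′))
    ... | no _  | yes p = ⊥-elim (ℕ.1+n≢n p)
    ... | no _  | no _  = refl

    covers : ∀ v w → w ≢ v → ∃ λ s → (∃ λ τ → τ ≤ h × a v s τ ≡ w) ⊎ (∃ λ τ → τ < h × b v s τ ≡ w)
    covers nothing nothing  w≢v = ⊥-elim (w≢v refl)
    covers nothing (just x) w≢v = tt , go (toℕ x) refl (halve (toℕ x))
      where
      go : ∀ i → i ≡ toℕ x → Halved i → (∃ λ τ → τ ≤ h × a nothing tt τ ≡ just x) ⊎
        (∃ λ τ → τ < h × b nothing tt τ ≡ just x)
      go _ e (twice τ)   = inj₁ (τ , ℕ.*-cancelʳ-≤ _ _ 2 (ℕ.s≤s⁻¹ (subst (_< N) (sym e) (toℕ<n x))) ,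
        cong just (trans (cong (λ i → ⟦ + i ⟧) e) (⟦ι⟧ x)))
      go _ e (twice+1 τ) = inj₂ (τ , *2-cancel-< (ℕ.s<s⁻¹ (subst (_< N) (sym e) (toℕ<n x))) , cong just
        (trans (cong (λ i → ⟦ + i ⟧) e) (⟦ι⟧ x)))
    covers (just j) w w≢v with factor-covers j w
    ... | zero  , _   , inj₁ e = tt , inj₁ (h , ℕ.≤-refl , trans (Pᶜ-r j) e)
    ... | zero  , _   , inj₂ e = ⊥-elim (w≢v (trans (sym e) (cong just (⟦ι⟧-cong 0ℤ refl))))
    ... | suc τ , τ<h , inj₁ e = tt , inj₁ (τ , ℕ.<⇒≤ (ℕ.s<s⁻¹ τ<h) , trans (Pᶜ-< j τ<h) e)
    ... | suc τ , τ<h , inj₂ e = tt , inj₂ (τ , ℕ.s<s⁻¹ τ<h , e)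

    Arc : U → U → U → Set
    Arc v x y = (∃ λ τ → τ < h × (Dir (κ v tt τ) (a v tt τ) (b v tt τ) x y ⊎ Dir (κ v tt τ) (a v tt (suc τ))
      (b v tt τ) x y))
              ⊎ Dir (κ v tt h) (a v tt h) (a v tt 0) x y

    dir : ∀ {κ κ′} {p q x y : U} → κ ≡ κ′ → Dir κ′ p q x y → Dir κ p q x y
    dir refl d = d

    double-h : ∀ k → + (h ℕ.* 2) + k * + N + 1ℤ ≡ (k + 1ℤ) * + N
    double-h k = trans (cong (λ z → z + k * + N + 1ℤ) (pos*2 h)) (l (+ h) k (+ N) +N)
      where
      l : ∀ h k n → n ≡ 1ℤ + (h + h) → h + h + k * n + 1ℤ ≡ (k + 1ℤ) * n
      l h k n refl = l′ h k
        where
        l′ : ∀ h k → h + h + k * (1ℤ + (h + h)) + 1ℤ ≡ (k + 1ℤ) * (1ℤ + (h + h))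
        l′ = solve-∀

    forward-even : ∀ x → odd (toℕ x) ≡ false → Arc nothing (just x) (just ⟦ ι x + 1ℤ ⟧)
    forward-even x e = go (toℕ x) refl (halve (toℕ x))
      where
      go : ∀ i → i ≡ toℕ x → Halved i → Arc nothing (just x) (just ⟦ ι x + 1ℤ ⟧)
      go _ i≡ (twice τ) with τ ℕ.<? h
      ... | yes τ<h = inj₁ (τ , τ<h , inj₁ (cong just (trans (cong (λ i → ⟦ + i ⟧) i≡) (⟦ι⟧ x)) ,
                        cong just (cong ⟦_⟧ (trans (cong (λ i → + suc i) i≡) (ℤ.+-comm 1ℤ (ι x))))))
      ... | no τ≮h  = inj₂ (cong just (trans (cong (λ i → ⟦ + (i ℕ.* 2) ⟧) (sym τ≡h))
        (trans (cong (λ i → ⟦ + i ⟧) i≡) (⟦ι⟧ x))) ,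
                        cong just (trans (sym ⟦N⟧) (cong ⟦_⟧
                          (trans (cong +_ (trans (cong (λ τ → suc (τ ℕ.* 2)) (sym τ≡h)) (cong suc i≡)))
                          (ℤ.+-comm 1ℤ (ι x))))))
        where
        τ≡h : τ ≡ h
        τ≡h = ℕ.≤-antisym (ℕ.*-cancelʳ-≤ _ _ 2 (ℕ.s≤s⁻¹ (subst (_< N) (sym i≡) (toℕ<n x)))) (ℕ.≮⇒≥ τ≮h)
      go _ i≡ (twice+1 τ) = ⊥-elim (clash (trans (sym (alt-odd _ _ τ)) (trans (cong odd i≡) e)))
        where
        clash : true ≢ false
        clash ()

    backward-odd : ∀ x → odd (toℕ x) ≡ true → Arc nothing (just ⟦ ι x + 1ℤ ⟧) (just x)
    backward-odd x e = go (toℕ x) refl (halve (toℕ x))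
      where
      go : ∀ i → i ≡ toℕ x → Halved i → Arc nothing (just ⟦ ι x + 1ℤ ⟧) (just x)
      go _ i≡ (twice+1 τ) = inj₁ (τ , *2-cancel-< (ℕ.s<s⁻¹ (subst (_< N) (sym i≡) (toℕ<n x))) ,
        inj₂ (cong just (cong ⟦_⟧ (trans (cong (λ i → + suc i) i≡) (ℤ.+-comm 1ℤ (ι x)))) , cong just
          (trans (cong (λ i → ⟦ + i ⟧) i≡) (⟦ι⟧ x))))
      go _ i≡ (twice τ) = ⊥-elim (clash (trans (sym (alt-even _ _ τ)) (trans (cong odd i≡) e)))
        where
        clash : false ≢ true
        clash ()

    -- As x - 2h = x + 1 modulo 2h + 1, the hole x - h is the one whose cycle ends with x, x + 1, ∞.
    last : ∀ x → P ⟦ ι x - + h ⟧ h ≡ just x × Q ⟦ ι x - + h ⟧ h ≡ just ⟦ ι x + 1ℤ ⟧ × κ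
      (just ⟦ ι x - + h ⟧) tt h′ ≡ odd (toℕ x)
    last x = cong just P≡ , cong just (trans (absorb (ι x - + h) (- + h))
      (⟦⟧-cong -1ℤ (l′ (ι x) (+ h) (+ N) +N))) ,
             trans (κ-h′ _) (cong (λ i → odd (toℕ i)) P≡)
      where
      l : ∀ x h n → x - h + h ≡ x + 0ℤ * n
      l = solve-∀
      P≡ : ⟦ ι ⟦ ι x - + h ⟧ + + h ⟧ ≡ x
      P≡ = trans (absorb (ι x - + h) (+ h)) (⟦ι⟧-cong 0ℤ (l (ι x) (+ h) (+ N)))
      l′ : ∀ x h n → n ≡ 1ℤ + (h + h) → x - h + - h ≡ x + 1ℤ + -1ℤ * n
      l′ x h n refl = l″ x h
        where
        l″ : ∀ x h → x - h + - h ≡ x + 1ℤ + -1ℤ * (1ℤ + (h + h))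
        l″ = solve-∀

    successor : ∀ x → ∃ λ v → Arc v (just x) (just ⟦ ι x + 1ℤ ⟧)
    successor x with odd (toℕ x) in e
    ... | false = nothing , forward-even x e
    ... | true  = let p , q , k = last x in just ⟦ ι x - + h ⟧ , inj₁ (h′ , ℕ.≤-refl , inj₁ (dir (trans k e) (trans (Pᶜ-< _ ℕ.≤-refl) p , q)))

    predecessor : ∀ x → ∃ λ v → Arc v (just ⟦ ι x + 1ℤ ⟧) (just x)
    predecessor x with odd (toℕ x) in e
    ... | true  = nothing , backward-odd x e
    ... | false = let p , q , k = last x in just ⟦ ι x - + h ⟧ , inj₁ (h′ , ℕ.≤-refl , inj₁ (dir (trans k e) (q , trans (Pᶜ-< _ ℕ.≤-refl) p)))

    first : ∀ x → Pᶜ x 1 ≡ just ⟦ ι x + 1ℤ ⟧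
    first x = Pᶜ-< x (s≤s (s≤s z≤n))

    from-∞ : ∀ x → ∃ λ v → Arc v nothing (just ⟦ ι x + 1ℤ ⟧)
    from-∞ x with odd (toℕ x) in e
    ... | false = just x , inj₂ (dir (trans (κ-h x) (cong not e)) (Pᶜ-r x , first x))
    ... | true  = let _ , q , k = last x in just ⟦ ι x - + h ⟧ , inj₁ (h′ , ℕ.≤-refl , inj₂ (dir (trans k e) (Pᶜ-r _ , q)))

    to-∞ : ∀ x → ∃ λ v → Arc v (just ⟦ ι x + 1ℤ ⟧) nothing
    to-∞ x with odd (toℕ x) in e
    ... | true  = just x , inj₂ (dir (trans (κ-h x) (cong not e)) (first x , Pᶜ-r x))
    ... | false = let _ , q , k = last x in just ⟦ ι x - + h ⟧ , inj₁ (h′ , ℕ.≤-refl , inj₂ (dir (trans k e) (q , Pᶜ-r _)))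

    pred-succ : ∀ x → ⟦ ι ⟦ ι x - 1ℤ ⟧ + 1ℤ ⟧ ≡ x
    pred-succ x = trans (absorb (ι x - 1ℤ) 1ℤ) (⟦ι⟧-cong 0ℤ (l (ι x) (+ N)))
      where
      l : ∀ x n → x - 1ℤ + 1ℤ ≡ x + 0ℤ * n
      l = solve-∀

    arcs : ∀ x y → x ≢ y → ∃ λ v → Arc v x y
    arcs nothing  nothing  x≢y = ⊥-elim (x≢y refl)
    arcs nothing  (just y) x≢y = subst (λ y → ∃ λ v → Arc v nothing (just y)) (pred-succ y)
      (from-∞ ⟦ ι y - 1ℤ ⟧)
    arcs (just x) nothing  x≢y = subst (λ x → ∃ λ v → Arc v (just x) nothing) (pred-succ x)
      (to-∞ ⟦ ι x - 1ℤ ⟧)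
    arcs (just x) (just y) x≢y = go (toℕ D) refl (halve (toℕ D))
      where
      D = ⟦ ι x - ι y ⟧
      k = (ι x - ι y) /ℕ N
      diff : ∀ {c} → c ≡ toℕ D → ι x - ι y ≡ + c + k * + N
      diff refl = lift _
      shift : ∀ {c d} → ι x - ι y ≡ c → d ≡ ι y + (c + (d - ι x))
      shift {c} {d} e = trans (l (ι x) (ι y) d) (cong (λ c → ι y + (c + (d - ι x))) e)
        where
        l : ∀ x y d → d ≡ y + (x - y + (d - x))
        l = solve-∀
      go : ∀ i → i ≡ toℕ D → Halved i → ∃ λ v → Arc v (just x) (just y)
      go _ e (twice zero) = ⊥-elim (x≢y (cong just (trans (sym (⟦ι⟧ x))
        (⟦ι⟧-cong k (trans (shift (diff e)) (l (ι x) (ι y) k (+ N)))))))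
        where
        l : ∀ x y k n → y + (0ℤ + k * n + (x - x)) ≡ y + k * n
        l = solve-∀
      go _ e (twice (suc c)) with c ℕ.<? h′
      ... | yes c<h′ = let p , q = even-difference x y k c (diff e) in
        just ⟦ ι y + + suc c ⟧ , inj₁ (c , ℕ.<⇒≤ (s≤s c<h′) , inj₁
          (dir (κ-< _ c<h′) (trans (Pᶜ-< _ (s≤s (ℕ.<⇒≤ (s≤s c<h′)))) p , q)))
      -- Now x - y = 2h = -1, so y is x + 1.
      ... | no c≮h′ = subst (λ y → ∃ λ v → Arc v (just x) (just y))
        (⟦ι⟧-cong (k + 1ℤ) (trans (shift (diff e)) (trans (l (ι x) (ι y) (+ (suc c ℕ.* 2)) k (+ N))
          (cong (λ z → ι y + z) (trans (cong (λ c → + (suc c ℕ.* 2) + k * + N + 1ℤ) c≡h′) (double-h k))))))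
            (successor x)
        where
        l : ∀ x y c k n → y + (c + k * n + (x + 1ℤ - x)) ≡ y + (c + k * n + 1ℤ)
        l = solve-∀
        c≡h′ : c ≡ h′
        c≡h′ = ℕ.≤-antisym (ℕ.s≤s⁻¹ (ℕ.*-cancelʳ-≤ (suc c) h 2 (ℕ.s≤s⁻¹ (subst (_< N) (sym e) (toℕ<n D)))))
          (ℕ.≮⇒≥ c≮h′)
      go _ e (twice+1 zero) = subst (λ x → ∃ λ v → Arc v (just x) (just y))
        (trans (⟦⟧-cong (- k) (trans (l (ι x) (ι y) (+ N) k)
          (cong (λ z → ι x + (1ℤ - z + k * + N) + - k * + N) (diff e))))
            (trans (cong ⟦_⟧ (l′ (ι x) k (+ N))) (⟦ι⟧ x))) (predecessor y)
        where
        l : ∀ x y n k → y + 1ℤ ≡ x + (1ℤ - (x - y) + k * n) + - k * n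
        l = solve-∀
        l′ : ∀ x k n → x + (1ℤ - (1ℤ + k * n) + k * n) ≡ x
        l′ = solve-∀
      -- The difference 2c + 3 = (c + 2) + (c + 1) is that of a_{c+1} and b_c around y + c + 1.
      go _ e (twice+1 (suc c)) = just v , inj₁ (c , ℕ.<-trans c<h′ (ℕ.n<1+n h′) , inj₂ (dir (κ-< v c<h′) (
          trans (Pᶜ-< v (s≤s (s≤s c<h′))) (cong just (trans (absorb (ι y + + suc c) (+ suc (suc c)))
            (⟦ι⟧-cong (- k) (trans (l (ι x) (ι y) (+ suc c))
            (trans (cong (λ z → 1ℤ + (+ suc c + + suc c) - z + ι x)
              (trans (diff e) (cong (_+ k * + N) (pos-1+*2 (suc c))))) (l′ (+ suc c) (ι x) k (+ N))))))) ,
          cong just (trans (absorb (ι y + + suc c) (- + suc c)) (⟦ι⟧-cong 0ℤ (l″ (ι y) (+ suc c) (+ N)))))))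
        where
        v = ⟦ ι y + + suc c ⟧
        c<h′ : c < h′
        c<h′ = ℕ.s<s⁻¹ (*2-cancel-< {suc c} {h} (ℕ.s<s⁻¹ (subst (_< N) (sym e) (toℕ<n D))))
        l : ∀ x y c → y + c + (1ℤ + c) ≡ 1ℤ + (c + c) - (x - y) + x
        l = solve-∀
        l′ : ∀ c x k n → 1ℤ + (c + c) - (1ℤ + (c + c) + k * n) + x ≡ x + - k * n
        l′ = solve-∀
        l″ : ∀ y c n → y + c - c ≡ y + 0ℤ * n
        l″ = solve-∀

  near : Near (suc h′) (Maybe (Fin (suc (suc h′ ℕ.* 2)))) ⊤
  near = record
    { a      = a
    ; b      = b
    ; κ      = κ
    ; covers = covers
    ; arcs   = λ x y x≢y → let v , arc = arcs x y x≢y in v , tt , arc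
    }

-- 2m + 1 points Z_{2m+1}, m = 2h + 1: the two cycles of the hole v are v ± C, where C runs through
-- h + 1, −(h + 2), h + 3, …, ±m, ∓1, ±2, …, h, with alternating signs.  Its vertices and its
-- differences are both representatives of the nonzero residues up to sign.
module NearTwo (h′ : ℕ) where
  private
    h m : ℕ
    h = suc h′
    m = suc (h ℕ.* 2)
    open Residue (m ℕ.* 2)

    U : Set
    U = Fin N

    +m : + m ≡ 1ℤ + (+ h + + h)
    +m = pos-1+*2 h

    +N : + N ≡ 1ℤ + (1ℤ + (+ h + + h) + (1ℤ + (+ h + + h)))
    +N = trans (pos-1+*2 m) (cong (λ m → 1ℤ + (m + m)) +m)

    -- The absolute values along C: a rotation of 1, ..., m. As m is odd, the closing edge joins
    -- entries of equal sign; the rotation makes these h and h + 1, with difference 1. The sums of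
    -- neighbours are 2h + 3, ..., 4h + 1, then m + 1 = -m modulo 2m + 1, then 3, ..., 2h - 1, so
    -- that up to sign every odd number below 2m occurs once.
    e : ℕ → ℕ
    e i with i ℕ.≤? h
    ... | yes _ = suc (h ℕ.+ i)
    ... | no _  = i ℕ.∸ h

    e-≤ : ∀ {i} → i ≤ h → e i ≡ suc (h ℕ.+ i)
    e-≤ {i} i≤h with i ℕ.≤? h
    ... | yes _ = refl
    ... | no ¬p = ⊥-elim (¬p i≤h)

    e-> : ∀ j → e (suc j ℕ.+ h) ≡ suc j
    e-> j with suc j ℕ.+ h ℕ.≤? h
    ... | yes p = ⊥-elim (ℕ.<⇒≱ (s≤s (ℕ.m≤n+m h j)) p)
    ... | no _  = ℕ.m+n∸n≡m (suc j) h

    a b : U → Bool → ℕ → U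
    a v s τ = ⟦ ι v + sgn s * + e (τ ℕ.* 2) ⟧
    b v s τ = ⟦ ι v - sgn s * + e (suc (τ ℕ.* 2)) ⟧

    h+h : h ℕ.+ h ≡ h ℕ.* 2
    h+h = trans (cong (h ℕ.+_) (sym (ℕ.+-identityʳ h))) (ℕ.*-comm 2 h)

    sgn-not : ∀ s → sgn (not s) ≡ - sgn s
    sgn-not true  = refl
    sgn-not false = refl

    e-onto : ∀ {c} → 1 ≤ c → c ≤ m → ∃ λ i → i ≤ h ℕ.* 2 × e i ≡ c
    e-onto {suc c} 1≤c c≤m with suc c ℕ.≤? h
    ... | yes c<h = suc c ℕ.+ h , ℕ.≤-trans (ℕ.+-monoˡ-≤ h c<h) (ℕ.≤-reflexive h+h) , e-> c
    ... | no c≮h  = c ℕ.∸ h , ℕ.≤-trans (ℕ.m∸n≤m c h) (ℕ.s≤s⁻¹ c≤m) , trans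
      (e-≤ (ℕ.≤-trans (ℕ.∸-monoˡ-≤ h (ℕ.s≤s⁻¹ c≤m)) (ℕ.≤-reflexive 2h-h)))
                      (cong suc (trans (ℕ.+-comm h _) (ℕ.m∸n+n≡m (ℕ.s≤s⁻¹ (ℕ.≰⇒> c≮h)))))
      where
      2h-h : h ℕ.* 2 ℕ.∸ h ≡ h
      2h-h = trans (cong (ℕ._∸ h) (sym h+h)) (ℕ.m+n∸n≡m h h)

    covers′ : ∀ v w σ c → 1 ≤ c → c ≤ m → ⟦ ι v + sgn σ * + c ⟧ ≡ w →
              ∃ λ s → (∃ λ τ → τ ≤ h × a v s τ ≡ w) ⊎ (∃ λ τ → τ < h × b v s τ ≡ w)
    covers′ v w σ c 1≤c c≤m eq with e-onto 1≤c c≤m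
    ... | i , i≤ , ei = go i i≤ ei (halve i)
      where
      go : ∀ i → i ≤ h ℕ.* 2 → e i ≡ c → Halved i → ∃ λ s → (∃ λ τ → τ ≤ h × a v s τ ≡ w) ⊎
        (∃ λ τ → τ < h × b v s τ ≡ w)
      go _ i≤ ei (twice τ) = σ , inj₁ (τ , ℕ.*-cancelʳ-≤ τ h 2 i≤ , trans
        (cong (λ c → ⟦ ι v + sgn σ * + c ⟧) ei) eq)
      go _ i≤ ei (twice+1 τ) = not σ , inj₂ (τ , *2-cancel-< i≤ , trans
        (cong ⟦_⟧ (trans (cong₂ (λ s c → ι v - s * + c) (sgn-not σ) ei)
          (l (ι v) (sgn σ) (+ c)))) eq)
        where
        l : ∀ v s c → v - (- s) * c ≡ v + s * c
        l = solve-∀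

    add : ∀ x y d k n → y - x ≡ d + k * n → x + d ≡ y + - k * n
    add x y d k n eq = trans (l x y d) (trans (cong (λ z → y - z + d) eq) (l′ y d k n))
      where
      l : ∀ x y d → x + d ≡ y - (y - x) + d
      l = solve-∀
      l′ : ∀ y d k n → y - (d + k * n) + d ≡ y + - k * n
      l′ = solve-∀

    opposite : ∀ d d′ k k′ → d′ ℕ.+ d ≡ N → k ≡ k′ - 1ℤ → + d + k * + N ≡ - + d′ + k′ * + N
    opposite d d′ k k′ eq refl = trans (cong (λ n → + d + (k′ - 1ℤ) * n) N≡)
      (trans (l (+ d) (+ d′) k′) (cong (λ n → - + d′ + k′ * n) (sym N≡)))
      where
      N≡ : + N ≡ + d′ + + d
      N≡ = trans (cong +_ (sym eq)) (ℤ.pos-+ d′ d)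
      l : ∀ d d′ k′ → d + (k′ - 1ℤ) * (d′ + d) ≡ - d′ + k′ * (d′ + d)
      l = solve-∀

    covers : ∀ v w → w ≢ v → ∃ λ s → (∃ λ τ → τ ≤ h × a v s τ ≡ w) ⊎ (∃ λ τ → τ < h × b v s τ ≡ w)
    covers v w w≢v = go (toℕ D) refl
      where
      D = ⟦ ι w - ι v ⟧
      k = (ι w - ι v) /ℕ N
      diff : ∀ {c} → c ≡ toℕ D → ι w - ι v ≡ + c + k * + N
      diff refl = lift _
      go : ∀ d → d ≡ toℕ D → ∃ λ s → (∃ λ τ → τ ≤ h × a v s τ ≡ w) ⊎ (∃ λ τ → τ < h × b v s τ ≡ w)
      go zero eq = ⊥-elim (w≢v (sym (trans (sym (⟦ι⟧ v)) (⟦ι⟧-cong (- k)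
        (trans (sym (ℤ.+-identityʳ (ι v))) (add (ι v) (ι w) 0ℤ k (+ N) (diff eq)))))))
      go (suc d) eq with suc d ℕ.≤? m
      ... | yes d<m = covers′ v w true (suc d) (s≤s z≤n) d<m
        (⟦ι⟧-cong (- k) (trans (cong (λ z → ι v + z) (ℤ.*-identityˡ (+ suc d)))
          (add (ι v) (ι w) (+ suc d) k (+ N) (diff eq))))
      ... | no d≮m = covers′ v w false d′ (ℕ.m<n⇒0<n∸m d<N) d′≤m
        (⟦ι⟧-cong (- (k + 1ℤ)) (trans (cong (λ z → ι v + z) (l (+ d′)))
          (add (ι v) (ι w) (- + d′) (k + 1ℤ) (+ N)
          (trans (diff eq) (opposite (suc d) d′ k (k + 1ℤ) (ℕ.m∸n+n≡m (ℕ.<⇒≤ d<N)) (l′ k))))))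
        where
        d′ = N ℕ.∸ suc d
        d<N : suc d < N
        d<N = subst (_< N) (sym eq) (toℕ<n D)
        d′≤m : d′ ≤ m
        d′≤m = ℕ.≤-trans (ℕ.∸-monoʳ-≤ N (ℕ.≰⇒> d≮m)) (ℕ.≤-reflexive
          (trans (cong (ℕ._∸ m) (trans (ℕ.*-comm m 2) (cong (m ℕ.+_) (ℕ.+-identityʳ m)))) (ℕ.m+n∸n≡m m m)))
        l : ∀ d → -1ℤ * d ≡ - d
        l = solve-∀
        l′ : ∀ k → k ≡ k + 1ℤ - 1ℤ
        l′ = solve-∀

    Arc : U → Bool → U → U → Set
    Arc v s x y = (∃ λ τ → τ < h × ((a v s τ ≡ x × b v s τ ≡ y) ⊎ (a v s (suc τ) ≡ x × b v s τ ≡ y)))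
                ⊎ (a v s h ≡ x × a v s 0 ≡ y)

    module _ (x y : U) where
      back : ∀ z → ⟦ ι ⟦ ι x - z ⟧ + z ⟧ ≡ x
      back z = trans (absorb (ι x - z) z) (⟦ι⟧-cong 0ℤ (l (ι x) z (+ N)))
        where
        l : ∀ x z n → x - z + z ≡ x + 0ℤ * n
        l = solve-∀

      forth : ∀ z w d k → - z + w ≡ d → ι y - ι x ≡ d + k * + N → ⟦ ι ⟦ ι x - z ⟧ + w ⟧ ≡ y
      forth z w d k refl eq = trans (absorb (ι x - z) w) (⟦ι⟧-cong (- k)
        (trans (l (ι x) z w) (add (ι x) (ι y) (- z + w) k (+ N) eq)))
        where
        l : ∀ x z w → x - z + w ≡ x + (- z + w)
        l = solve-∀

      step : ∀ s i k → i < h ℕ.* 2 → ι y - ι x ≡ - (sgn s * (+ e i + + e (suc i))) + k * + N → ∃ λ v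
        → Arc v s x y
      step s i k i<2h eq = go i i<2h eq (halve i)
        where
        go : ∀ i → i < h ℕ.* 2 → ι y - ι x ≡ - (sgn s * (+ e i + + e (suc i))) + k * + N → Halved i → ∃ λ v
          → Arc v s x y
        go _ i< eq (twice τ) = ⟦ ι x - sgn s * + e (τ ℕ.* 2) ⟧ , inj₁ (τ , *2-cancel-< i< ,
          inj₁ (back (sgn s * + e (τ ℕ.* 2)) , forth (sgn s * + e (τ ℕ.* 2))
            (- (sgn s * + e (suc (τ ℕ.* 2)))) _ k (l (sgn s) (+ e (τ ℕ.* 2)) (+ e (suc (τ ℕ.* 2)))) eq))
          where
          l : ∀ s c d → - (s * c) + - (s * d) ≡ - (s * (c + d))
          l = solve-∀
        go _ i< eq (twice+1 τ) = ⟦ ι x - sgn s * + e (suc τ ℕ.* 2) ⟧ , inj₁ (τ , *2-cancel-< (ℕ.<⇒≤ i<) ,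
          inj₂ (back (sgn s * + e (suc τ ℕ.* 2)) , forth (sgn s * + e (suc τ ℕ.* 2))
            (- (sgn s * + e (suc (τ ℕ.* 2)))) _ k (l (sgn s) (+ e (suc (τ ℕ.* 2))) (+ e (suc τ ℕ.* 2))) eq))
          where
          l : ∀ s c d → - (s * d) + - (s * c) ≡ - (s * (c + d))
          l = solve-∀

      close : ∀ s k → ι y - ι x ≡ sgn s + k * + N → ∃ λ v → Arc v s x y
      close s k eq = ⟦ ι x - sgn s * + e (h ℕ.* 2) ⟧ , inj₂ (back (sgn s * + e (h ℕ.* 2)) , forth
        (sgn s * + e (h ℕ.* 2)) (sgn s * + e 0) _ k
          (trans (cong₂ (λ p q → - (sgn s * p) + sgn s * q) (cong +_ last)
            (cong +_ (trans (e-≤ {0} z≤n) (cong suc (ℕ.+-identityʳ h))))) (l (sgn s) (+ h))) eq)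
        where
        last : e (h ℕ.* 2) ≡ h
        last = trans (cong e (sym h+h)) (e-> h′)
        l : ∀ s h → - (s * h) + s * (1ℤ + h) ≡ s
        l = solve-∀

      -- The sum 2c + 1 arises where `e` passes from c to c + 1. The exceptions are c = 0, served by
      -- the closing edge, and c = h, served by the jump from m to 1.
      odd-difference : ∀ s c k → c ≤ h ℕ.* 2 → ι y - ι x ≡ - (sgn s * + suc (c ℕ.* 2)) + k * + N → ∃ λ v
        → ∃ λ s → Arc v s x y
      odd-difference s zero k c≤ eq = let v , arc = close (not s) k (trans eq (cong (_+ k * + N) (trans (l (sgn s)) (sym (sgn-not s))))) in v , not s , arc
        where
        l : ∀ s → - (s * 1ℤ) ≡ - s
        l = solve-∀
      odd-difference s c@(suc c₁) k c≤ eq with ℕ.<-cmp c h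
      ... | tri< c<h _ _ = let v , arc = step s (c ℕ.+ h) k (ℕ.<-≤-trans (ℕ.+-monoˡ-< h c<h) (ℕ.≤-reflexive h+h))
                                   (trans eq (cong (λ z → - (sgn s * z) + k * + N)
                                     (trans (pos-1+*2 c) (trans (l (+ c))
                                     (cong₂ (λ p q → + p + + q) (sym (e-> c₁)) (sym (e-> c)))))))
                           in v , s , arc
        where
        l : ∀ c → 1ℤ + (c + c) ≡ c + (1ℤ + c)
        l = solve-∀
      ... | tri> _ _ h<c = let v , arc = step s i k (ℕ.<-≤-trans i<h (ℕ.m≤m*n h 2))
                                   (trans eq (cong (λ z → - (sgn s * z) + k * + N)
                                     (trans (pos-1+*2 c) (trans (l (+ c)) (cong₂ (λ p q → + p + + q)
                                     (sym (trans (e-≤ (ℕ.<⇒≤ i<h)) i+h))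
                                       (sym (trans (e-≤ i<h)
                                       (trans (cong suc (ℕ.+-suc h i)) (cong suc i+h)))))))))
                           in v , s , arc
        where
        i = c ℕ.∸ suc h
        i+h : suc (h ℕ.+ i) ≡ c
        i+h = trans (ℕ.+-comm (suc h) i) (ℕ.m∸n+n≡m h<c)
        i<h : i < h
        i<h = ℕ.+-cancelˡ-≤ h (suc i) h (ℕ.≤-trans (ℕ.≤-reflexive (trans (ℕ.+-suc h i) i+h))
          (ℕ.≤-trans c≤ (ℕ.≤-reflexive (sym h+h))))
        l : ∀ c → 1ℤ + (c + c) ≡ c + (1ℤ + c)
        l = solve-∀
      -- The jump has the sum 2h + 2, and 2h + 1 = -(2h + 2) modulo N; hence the other cycle and the
      -- shift of `k` by `sgn s`.
      ... | tri≈ _ refl _ = let v , arc = step (not s) h (k - sgn s) (ℕ.<-≤-trans (ℕ.m<m+n h (s≤s z≤n)) (ℕ.≤-reflexive h+h)) shifted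
                            in v , not s , arc
        where
        ends : + e h + + e (suc h) ≡ 1ℤ + (+ h + + h) + 1ℤ
        ends = cong₂ (λ p q → + p + + q) (e-≤ ℕ.≤-refl) (e-> 0)
        l : ∀ s h k → - (s * (1ℤ + (h + h))) + k * (1ℤ + (1ℤ + (h + h) + (1ℤ + (h + h)))) ≡
                      - (- s * (1ℤ + (h + h) + 1ℤ)) + (k - s) * (1ℤ + (1ℤ + (h + h) + (1ℤ + (h + h))))
        l = solve-∀
        shifted : ι y - ι x ≡ - (sgn (not s) * (+ e h + + e (suc h))) + (k - sgn s) * + N
        shifted = begin
          ι y - ι x                                               ≡⟨ eq ⟩
          - (sgn s * + m) + k * + N                               ≡⟨ cong₂
            (λ m n → - (sgn s * m) + k * n) +m +N ⟩
          _                                                       ≡⟨ l (sgn s) (+ h) k ⟩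
          _                                                       ≡⟨ cong₂
            (λ p n → - (- sgn s * p) + (k - sgn s) * n) (sym ends) (sym +N) ⟩
          - (- sgn s * (+ e h + + e (suc h))) + (k - sgn s) * + N ≡⟨ cong
            (λ p → - (p * (+ e h + + e (suc h))) + (k - sgn s) * + N) (sym (sgn-not s)) ⟩
          _                                                       ∎
          where open ≡-Reasoning

    arcs : ∀ x y → x ≢ y → ∃ λ v → ∃ λ s → Arc v s x y
    arcs x y x≢y = go (toℕ D) refl (halve (toℕ D))
      where
      D = ⟦ ι y - ι x ⟧
      k = (ι y - ι x) /ℕ N
      diff : ∀ {c} → c ≡ toℕ D → ι y - ι x ≡ + c + k * + N
      diff refl = lift _
      go : ∀ d → d ≡ toℕ D → Halved d → ∃ λ v → ∃ λ s → Arc v s x y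
      go _ eq (twice zero) = ⊥-elim (x≢y (trans (sym (⟦ι⟧ x))
        (⟦ι⟧-cong (- k) (trans (sym (ℤ.+-identityʳ (ι x))) (add (ι x) (ι y) 0ℤ k (+ N) (diff eq))))))
      go _ eq (twice+1 c) = odd-difference x y false c k (ℕ.s≤s⁻¹
        (*2-cancel-< (ℕ.s<s⁻¹ (subst (_< N) (sym eq) (toℕ<n D)))))
        (trans (diff eq) (cong (_+ k * + N) (l (+ suc (c ℕ.* 2)))))
        where
        l : ∀ c → c ≡ - (-1ℤ * c)
        l = solve-∀
      -- An even difference 2c + 2 is minus the odd number N - (2c + 2) = 2(2h - c) + 1.
      go _ eq (twice (suc c)) = odd-difference x y true (h ℕ.* 2 ℕ.∸ c) (k + 1ℤ) (ℕ.m∸n≤m (h ℕ.* 2) c)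
          (trans (diff eq) (trans (opposite (suc c ℕ.* 2) (suc ((h ℕ.* 2 ℕ.∸ c) ℕ.* 2)) k (k + 1ℤ) total
            (l′ k)) (cong (λ z → - z + (k + 1ℤ) * + N) (sym (ℤ.*-identityˡ
            (+ suc ((h ℕ.* 2 ℕ.∸ c) ℕ.* 2)))))))
        where
        c≤ : c ≤ h ℕ.* 2
        c≤ = ℕ.s≤s⁻¹ (ℕ.*-cancelʳ-≤ (suc c) m 2 (ℕ.s≤s⁻¹ (subst (_< N) (sym eq) (toℕ<n D))))
        total : suc ((h ℕ.* 2 ℕ.∸ c) ℕ.* 2) ℕ.+ suc c ℕ.* 2 ≡ N
        total = cong suc (trans (sym (ℕ.*-distribʳ-+ 2 (h ℕ.* 2 ℕ.∸ c) (suc c)))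
          (cong (ℕ._* 2) (trans (ℕ.+-suc _ c) (cong suc (ℕ.m∸n+n≡m c≤)))))
        l′ : ∀ k → k ≡ k + 1ℤ - 1ℤ
        l′ = solve-∀

  near : Near (suc h′) (Fin (suc (suc (suc h′ ℕ.* 2) ℕ.* 2))) Bool
  near = record
    { a      = a
    ; b      = b
    ; κ      = λ _ _ _ → true
    ; covers = covers
    ; arcs   = arcs
    }

-- Idempotent quasigroups of odd order and of even order at least 4.

-- An idempotent quasigroup, without its diagonal.
record Idempotent (S : Set) : Set where
  field
    _≟_   : DecidableEquality S
    ρ     : S → S → S
    onto  : ∀ i b → b ≢ i → ∃ λ a → a ≢ i × ρ i a ≡ b
    solve : ∀ a b → a ≢ b → ∃ λ i → i ≢ a × ρ i a ≡ b

module Cyclic (q : ℕ) where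
  open Residue (q ℕ.* 2)

  reflect : Fin N → Fin N → Fin N
  reflect i a = ⟦ (ι i + ι i) - ι a ⟧

  reflect² : ∀ i a → reflect i (reflect i a) ≡ a
  reflect² i a = trans (trans (cong ⟦_⟧ (l (ι i) (ι (reflect i a))))
    (trans (cong (λ z → ⟦ - z + (ι i + ι i) ⟧) back)
      (cong ⟦_⟧ (l′ (ι i) (ι a) k (+ N))))) (⟦ι⟧-cong k refl)
    where
    k = ((ι i + ι i) - ι a) /ℕ N
    l : ∀ i r → i + i - r ≡ - r + (i + i)
    l = solve-∀
    back : ι (reflect i a) ≡ (ι i + ι i) - ι a - k * + N
    back = trans (m (ι (reflect i a)) (k * + N)) (cong (_- k * + N) (sym (lift ((ι i + ι i) - ι a))))
      where
      m : ∀ r z → r ≡ r + z - z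
      m = solve-∀
    l′ : ∀ i a k n → - (i + i - a - k * n) + (i + i) ≡ a + k * n
    l′ = solve-∀

  reflect-self : ∀ i → reflect i i ≡ i
  reflect-self i = ⟦ι⟧-cong 0ℤ (l (ι i) (+ N))
    where
    l : ∀ i n → i + i - i ≡ i + 0ℤ * n
    l = solve-∀

  reflect-≢ : ∀ {i b} → b ≢ i → reflect i b ≢ i
  reflect-≢ {i} {b} b≢i e = b≢i (trans (sym (reflect² i b)) (trans (cong (reflect i) e) (reflect-self i)))

  -- Halving modulo 2q + 1 is multiplication by q + 1.
  middle : ∀ a b → reflect ⟦ (+ suc q) * (ι a + ι b) ⟧ a ≡ b
  middle a b = ⟦ι⟧-cong (1ℤ * (ι a + ι b) - (k + k)) (trans (cong (λ z → z + z - ι a) back)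
      (l (ι a) (ι b) (+ q) k (+ N) (pos-1+*2 q)))
    where
    z₀ = (+ suc q) * (ι a + ι b)
    k = z₀ /ℕ N
    back : ι ⟦ z₀ ⟧ ≡ z₀ - k * + N
    back = trans (m (ι ⟦ z₀ ⟧) (k * + N)) (cong (_- k * + N) (sym (lift z₀)))
      where
      m : ∀ r z → r ≡ r + z - z
      m = solve-∀
    l : ∀ a b q k n → n ≡ 1ℤ + (q + q) → ((1ℤ + q) * (a + b) - k * n) +
      ((1ℤ + q) * (a + b) - k * n) - a ≡ b + (1ℤ * (a + b) - (k + k)) * n
    l a b q k n refl = l′ a b q k
      where
      l′ : ∀ a b q k → ((1ℤ + q) * (a + b) - k * (1ℤ + (q + q))) +
        ((1ℤ + q) * (a + b) - k * (1ℤ + (q + q))) - a ≡ b + (1ℤ * (a + b) - (k + k)) * (1ℤ + (q + q))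
      l′ = solve-∀

  abstract
    midpoint : ∀ a b → a ≢ b → ∃ λ i → i ≢ a × reflect i a ≡ b
    midpoint a b a≢b = ⟦ (+ suc q) * (ι a + ι b) ⟧ , (λ e → a≢b
      (trans (sym (reflect-self a)) (trans (cong (λ i → reflect i a) (sym e)) (middle a b)))) , middle a b

idempotent-odd : ∀ q → Idempotent (Fin (suc (q ℕ.* 2)))
idempotent-odd q = record
  { _≟_   = _≟F_
  ; ρ     = reflect
  ; onto  = λ i b b≢i → reflect i b , reflect-≢ b≢i , reflect² i b
  ; solve = midpoint
  }
  where open Cyclic q

-- The prolongation of the quasigroup 2i − a along the transversal a = i + 1.
module Prolongation (q′ : ℕ) where
  private
    open Cyclic (suc q′)
    open Residue (suc q′ ℕ.* 2)

    S : Set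
    S = Maybe (Fin N)

    _⊕_ : Fin N → ℤ → Fin N
    a ⊕ z = ⟦ ι a + z ⟧

    ⊕-⊕ : ∀ a z w c → z + w ≡ c → (a ⊕ z) ⊕ w ≡ a ⊕ c
    ⊕-⊕ a z w c refl = trans (absorb (ι a + z) w) (cong ⟦_⟧ (ℤ.+-assoc (ι a) z w))

    ⊕-0 : ∀ a → a ⊕ 0ℤ ≡ a
    ⊕-0 a = ⟦ι⟧-cong 0ℤ refl

    ⊕-inverse : ∀ a z → (a ⊕ (- z)) ⊕ z ≡ a
    ⊕-inverse a z = trans (⊕-⊕ a (- z) z 0ℤ (ℤ.+-inverseˡ z)) (⊕-0 a)

    -- N ≥ 3 keeps the transversal a = i + 1 off the diagonal; for N = 1 the two would coincide.
    ⊕1-≢ : ∀ a → a ⊕ 1ℤ ≢ a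
    ⊕1-≢ a e with ⟦⟧-injective {ι a + 1ℤ} {ι a} (trans e (sym (⟦ι⟧ a)))
    ... | k , eq = one k (trans (l (ι a)) (trans (cong (_- ι a) eq) (l′ (ι a) (k * + N))))
      where
      l : ∀ a → 1ℤ ≡ a + 1ℤ - a
      l = solve-∀
      l′ : ∀ a z → a + z - a ≡ z
      l′ = solve-∀
      one : ∀ k → 1ℤ ≢ k * + N
      one (+ zero) ()
      one (+ suc k) ()
      one -[1+ k ] ()

    reflect-⊕1 : ∀ i → reflect i (i ⊕ 1ℤ) ≡ i ⊕ -1ℤ
    reflect-⊕1 i = trans (cong (reflect i) (sym eq)) (reflect² i (i ⊕ -1ℤ))
      where
      k = (ι i + -1ℤ) /ℕ N
      back : ι (i ⊕ -1ℤ) ≡ ι i + -1ℤ - k * + N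
      back = trans (m (ι (i ⊕ -1ℤ)) (k * + N)) (cong (_- k * + N) (sym (lift (ι i + -1ℤ))))
        where
        m : ∀ r z → r ≡ r + z - z
        m = solve-∀
      eq : reflect i (i ⊕ -1ℤ) ≡ i ⊕ 1ℤ
      eq = ⟦⟧-cong k (trans (cong (λ z → ι i + ι i - z) back) (l (ι i) k (+ N)))
        where
        l : ∀ i k n → i + i - (i + -1ℤ - k * n) ≡ i + 1ℤ + k * n
        l = solve-∀

    -- The cell (i, i + 1) of the transversal gives up its value i - 1 for the new element
    -- `nothing`. That value moves to (i, ∞) and, written as a - 2 with a = i + 1, to (∞, a).
    ρ : S → S → S
    ρ nothing  nothing  = nothing
    ρ nothing  (just a) = just (a ⊕ (- + 2))
    ρ (just i) nothing  = just (i ⊕ -1ℤ)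
    ρ (just i) (just a) with a ≟F (i ⊕ 1ℤ)
    ... | yes _ = nothing
    ... | no _  = just (reflect i a)

    ρ-yes : ∀ i a → a ≡ i ⊕ 1ℤ → ρ (just i) (just a) ≡ nothing
    ρ-yes i a e with a ≟F (i ⊕ 1ℤ)
    ... | yes _ = refl
    ... | no ¬e = ⊥-elim (¬e e)

    ρ-no : ∀ i a → a ≢ i ⊕ 1ℤ → ρ (just i) (just a) ≡ just (reflect i a)
    ρ-no i a ¬e with a ≟F (i ⊕ 1ℤ)
    ... | yes e = ⊥-elim (¬e e)
    ... | no _  = refl

    onto : ∀ i b → b ≢ i → ∃ λ a → a ≢ i × ρ i a ≡ b
    onto nothing  nothing  b≢i = ⊥-elim (b≢i refl)
    onto nothing  (just b) b≢i = just (b ⊕ (+ 2)) , (λ ()) , cong just (⊕-inverse b (- + 2))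
    onto (just i) nothing  b≢i = just (i ⊕ 1ℤ) , (λ e → ⊕1-≢ i (Maybe.just-injective e)) , ρ-yes i
      (i ⊕ 1ℤ) refl
    onto (just i) (just b) b≢i with b ≟F (i ⊕ -1ℤ)
    ... | yes refl = nothing , (λ ()) , refl
    ... | no b≢ = just (reflect i b) , (λ e → reflect-≢ (λ e → b≢i (cong just e))
      (Maybe.just-injective e)) ,
      trans (ρ-no i (reflect i b) (λ e → b≢ (trans (sym (reflect² i b))
        (trans (cong (reflect i) e) (reflect-⊕1 i))))) (cong just (reflect² i b))

    solve : ∀ a b → a ≢ b → ∃ λ i → i ≢ a × ρ i a ≡ b
    solve nothing  nothing  a≢b = ⊥-elim (a≢b refl)
    solve nothing  (just b) a≢b = just (b ⊕ 1ℤ) , (λ ()) , cong just (⊕-inverse b -1ℤ)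
    solve (just a) nothing  a≢b = just (a ⊕ -1ℤ) ,
      (λ e → ⊕1-≢ a (trans (cong (_⊕ 1ℤ) (sym (Maybe.just-injective e))) (⊕-inverse a 1ℤ))) , ρ-yes
        (a ⊕ -1ℤ) a (sym (⊕-inverse a 1ℤ))
    solve (just a) (just b) a≢b with b ≟F (a ⊕ (- + 2))
    ... | yes refl = nothing , (λ ()) , refl
    ... | no b≢ with midpoint a b (λ e → a≢b (cong just e))
    ...   | i , i≢a , e = just i , (λ e → i≢a (Maybe.just-injective e)) , trans (ρ-no i a a≢) (cong just e)
      where
      a≢ : a ≢ i ⊕ 1ℤ
      a≢ refl = b≢ (trans (sym e) (trans (reflect-⊕1 i) (sym (⊕-⊕ i 1ℤ (- + 2) -1ℤ refl))))

  idempotent-even : Idempotent (Maybe (Fin (suc (suc q′ ℕ.* 2))))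
  idempotent-even = record { _≟_ = Maybe.≡-dec _≟F_ ; ρ = ρ ; onto = onto ; solve = solve }

-- The points are S × Z_m ∪ {∞}.  Each S-class together with ∞ carries a copy of the given scheme.
-- The edges between two classes are covered by cycles which alternate between the classes A and ρ i A
-- while following a closed walk of the wheel, and which advance by 1 in Z_m after each round;
-- they are appended to the factors whose hole lies in the class i.
module Frame {m′ l′ k : ℕ} {S G D C : Set} (quasi : Idempotent S) (wheel : Wheel (suc (l′ ℕ.* 2)) G D C)
             (k≡ : k ≡ suc m′ ℕ.* (suc l′ ℕ.* 2))
             (small : Scheme (Maybe (Fin (suc m′))) G D (⊤ × C) k) where
  private
    open Idempotent quasi
    module W = Wheel wheel
    module I = Scheme small
    module Z = Residue m′
    open Residue (suc (l′ ℕ.* 2)) using (N; ⟦_⟧; ⟦ι⟧; ⟦N⟧)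
    m = suc m′
    n′ = suc (l′ ℕ.* 2)

    U : Set
    U = Maybe (S × Fin m)

    embU : S → Maybe (Fin m) → U
    embU A nothing  = nothing
    embU A (just z) = just (A , z)

    emb : S → Maybe (Fin m) × G → U × G
    emb A (p , x) = embU A p , x

    -- The coordinate a of the hole serves as the difference between the two classes. It is a on
    -- every step but the last of a round, where it is a - 1; for each wheel step, the m holes of
    -- the class i thus reach all pairs of points between A and ρ i A.
    side : S → S → Fin m → ℕ → ℕ → U
    side i A a t = alt (λ _ → just (A , Z.⟦ + t ⟧)) (λ _ → just (ρ i A , Z.⟦ + t + ι a ⟧))

    cell : S → S → Fin m → D → C → ℕ → ℕ → U × G
    cell i A a d c t l = side i A a t l , W.ω d c ⟦ + l ⟧

    γ : U → D → S × C → ℕ → U × G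
    γ nothing        d (A , c) q = emb A (I.γ nothing d (tt , c) q)
    γ (just (i , a)) d (A , c) q with A ≟ i
    ... | yes _ = emb A (I.γ (just a) d (tt , c) q)
    ... | no _  = walk n′ (cell i A a d c) q

    lab : U → D → S × C → ℕ → Bool
    lab nothing        d (A , c) q = I.lab nothing d (tt , c) q
    lab (just (i , a)) d (A , c) q with A ≟ i
    ... | yes _ = I.lab (just a) d (tt , c) q
    ... | no _  = walk n′ (λ _ → odd) q

    γ-small : ∀ A p d c q → γ (embU A p) d (A , c) q ≡ emb A (I.γ p d (tt , c) q)
    γ-small A nothing  d c q = refl
    γ-small A (just a) d c q with A ≟ A
    ... | yes _ = refl
    ... | no ¬e = ⊥-elim (¬e refl)

    lab-small : ∀ A p d c q → lab (embU A p) d (A , c) q ≡ I.lab p d (tt , c) q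
    lab-small A nothing  d c q = refl
    lab-small A (just a) d c q with A ≟ A
    ... | yes _ = refl
    ... | no ¬e = ⊥-elim (¬e refl)

    γ-frame : ∀ {A i} → A ≢ i → ∀ a d c q → γ (just (i , a)) d (A , c) q ≡ walk n′ (cell i A a d c) q
    γ-frame {A} {i} A≢i a d c q with A ≟ i
    ... | yes e = ⊥-elim (A≢i e)
    ... | no _  = refl

    lab-frame : ∀ {A i} → A ≢ i → ∀ a d c q → lab (just (i , a)) d (A , c) q ≡ walk n′ (λ _ → odd) q
    lab-frame {A} {i} A≢i a d c q with A ≟ i
    ... | yes e = ⊥-elim (A≢i e)
    ... | no _  = refl

    closed : ∀ h d c → γ h d c k ≡ γ h d c 0
    closed nothing        d (A , c) = cong (emb A) (I.closed nothing d (tt , c))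
    closed (just (i , a)) d (A , c) with A ≟ i
    ... | yes _ = cong (emb A) (I.closed (just a) d (tt , c))
    ... | no _  = trans (cong (walk n′ F) k≡) (trans (walk-at F m z<s)
        (trans (cong (λ z → just (A , z) , W.ω d c ⟦ 0ℤ ⟧) Z.⟦N⟧) (sym (walk-at F 0 z<s))))
      where
      F : ℕ → ℕ → U × G
      F = cell i A a d c

    bound : ∀ {t i} → t < m → i < N → i ℕ.+ t ℕ.* N < k
    bound {t} {i} t<m i<N = subst (λ k → i ℕ.+ t ℕ.* N < k) (sym k≡) (walk-< {m} {N} {t} t<m i<N)

    cell-even : ∀ i A a d c t τ → cell i A a d c t (τ ℕ.* 2) ≡
      (just (A , Z.⟦ + t ⟧) , W.ω d c ⟦ + (τ ℕ.* 2) ⟧)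
    cell-even i A a d c t τ = cong (_, W.ω d c ⟦ + (τ ℕ.* 2) ⟧) (alt-even _ _ τ)

    cell-odd : ∀ i A a d c t τ → cell i A a d c t (suc (τ ℕ.* 2)) ≡
      (just (ρ i A , Z.⟦ + t + ι a ⟧) , W.ω d c ⟦ + suc (τ ℕ.* 2) ⟧)
    cell-odd i A a d c t τ = cong (_, W.ω d c ⟦ + suc (τ ℕ.* 2) ⟧) (alt-odd _ _ τ)

    add-diff : ∀ (t z : Fin m) → Z.⟦ ι t + ι Z.⟦ ι z - ι t ⟧ ⟧ ≡ z
    add-diff t z = trans (cong Z.⟦_⟧ (ℤ.+-comm (ι t) (ι Z.⟦ ι z - ι t ⟧)))
      (trans (Z.absorb (ι z - ι t) (ι t)) (Z.⟦ι⟧-cong 0ℤ (l (ι z) (ι t) (+ m))))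
      where
      l : ∀ z t n → z - t + t ≡ z + 0ℤ * n
      l = solve-∀

    diff-add : ∀ (a z : Fin m) → Z.⟦ ι Z.⟦ ι z - ι a ⟧ + ι a ⟧ ≡ z
    diff-add a z = trans (cong Z.⟦_⟧ (ℤ.+-comm (ι Z.⟦ ι z - ι a ⟧) (ι a))) (add-diff a z)

    -- A class plays two roles: at even wheel positions it is visited as A, at odd ones as the image
    -- ρ i B of another class B.
    covers-frame : ∀ i a d A z j → A ≢ i → ∀ c → ∃ λ B → ∃ λ q → q < k × γ (just (i , a)) d (B , c) q ≡
      (just (A , z) , W.ω d c j)
    covers-frame i a d A z j A≢i c = go (toℕ j) refl (halve (toℕ j))
      where
      go : ∀ l → l ≡ toℕ j → Halved l → ∃ λ B → ∃ λ q → q < k × γ (just (i , a)) d (B , c) q ≡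
        (just (A , z) , W.ω d c j)
      go l e (twice τ) = A , l ℕ.+ toℕ z ℕ.* N , bound (toℕ<n z) l<N ,
        trans (γ-frame A≢i a d c _) (trans (walk-at (cell i A a d c) (toℕ z) l<N)
          (trans (cell-even i A a d c (toℕ z) τ)
          (cong₂ (λ z j → just (A , z) , W.ω d c j) (Z.⟦ι⟧ z) (trans (cong (λ l → ⟦ + l ⟧) e) (⟦ι⟧ j)))))
        where
        l<N : l < N
        l<N = subst (_< N) (sym e) (toℕ<n j)
      go l e (twice+1 τ) with onto i A A≢i
      ... | B , B≢i , refl = B , l ℕ.+ toℕ t ℕ.* N , bound (toℕ<n t) l<N ,
        trans (γ-frame B≢i a d c _) (trans (walk-at (cell i B a d c) (toℕ t) l<N)
          (trans (cell-odd i B a d c (toℕ t) τ)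
          (cong₂ (λ z j → just (A , z) , W.ω d c j) (diff-add a z)
            (trans (cong (λ l → ⟦ + l ⟧) e) (⟦ι⟧ j)))))
        where
        t : Fin m
        t = Z.⟦ ι z - ι a ⟧
        l<N : l < N
        l<N = subst (_< N) (sym e) (toℕ<n j)

    covers : ∀ h d w x → w ≢ h → ∃ λ c → ∃ λ q → q < k × γ h d c q ≡ (w , x)
    covers nothing d nothing x w≢h = ⊥-elim (w≢h refl)
    covers nothing d (just (A , z)) x w≢h with I.covers nothing d (just z) x (λ ())
    ... | (tt , c) , q , q<k , e = (A , c) , q , q<k , cong (emb A) e
    covers (just (i , a)) d nothing x w≢h with I.covers (just a) d nothing x (λ ())
    ... | (tt , c) , q , q<k , e = (i , c) , q , q<k , trans (γ-small i (just a) d c q) (cong (emb i) e)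
    covers (just (i , a)) d (just (A , z)) x w≢h = go (A ≟ i)
      where
      go : Dec (A ≡ i) → ∃ λ c → ∃ λ q → q < k × γ (just (i , a)) d c q ≡ (just (A , z) , x)
      go (yes refl) with I.covers (just a) d (just z) x (λ e → w≢h (cong (embU i) e))
      ... | (tt , c) , q , q<k , e = (i , c) , q , q<k , trans (γ-small i (just a) d c q) (cong (emb i) e)
      go (no A≢i) with W.covers d x
      ... | c , j , refl with covers-frame i a d A z j A≢i c
      ...   | B , q , q<k , e = (B , c) , q , q<k , e

    Joined : Bool → U × G → U × G → Set
    Joined ℓ v w = ∃ λ h → ∃ λ d → ∃ λ c → ∃ λ q → q < k × lab h d c q ≡ ℓ × Same (γ h d c q)
      (γ h d c (suc q)) v w

    joins-small : ∀ A p q x y → p ≢ q → x ≢ y → ∀ ℓ → Joined ℓ (embU A p , x) (embU A q , y)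
    joins-small A p q x y p≢q x≢y ℓ with I.joins p q x y p≢q x≢y ℓ
    ... | h , d , (tt , c) , i , i<k , l , s = embU A h , d , (A , c) , i , i<k , trans
      (lab-small A h d c i) l ,
      Same-resp (γ-small A h d c i) (γ-small A h d c (suc i)) (Same-map (emb A) s)

    frame-step : ∀ i B a d c t l {v w} → B ≢ i → t < m → l < N → cell i B a d c t l ≡ v →
                 walk n′ (cell i B a d c) (suc l ℕ.+ t ℕ.* N) ≡ w → Joined (odd l) v w
    frame-step i B a d c t l B≢i t<m l<N e e′ = just (i , a) , d , (B , c) , l ℕ.+ t ℕ.* N , bound t<m l<N ,
      trans (lab-frame B≢i a d c _) (walk-at (λ _ → odd) t l<N) ,
      inj₁ (trans (γ-frame B≢i a d c _) (trans (walk-at (cell i B a d c) t l<N) e) , trans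
        (γ-frame B≢i a d c _) e′)

    joins-frame : ∀ A B z w d c j → A ≢ B → Joined (odd (toℕ j)) (just (A , z) , W.ω d c j)
      (just (B , w) , W.ω d c ⟦ ι j + 1ℤ ⟧)
    joins-frame A B z w d c j A≢B = go (toℕ j) refl (halve (toℕ j))
      where
      here : ∀ {l} → l ≡ toℕ j → W.ω d c ⟦ + l ⟧ ≡ W.ω d c j
      here e = cong (W.ω d c) (trans (cong (λ l → ⟦ + l ⟧) e) (⟦ι⟧ j))
      there : ∀ {l} → l ≡ toℕ j → W.ω d c ⟦ + suc l ⟧ ≡ W.ω d c ⟦ ι j + 1ℤ ⟧
      there refl = cong (λ z → W.ω d c ⟦ z ⟧) (ℤ.+-comm 1ℤ (ι j))
      below : ∀ {l} → l ≡ toℕ j → l < N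
      below e = subst (_< N) (sym e) (toℕ<n j)
      go : ∀ l → l ≡ toℕ j → Halved l → Joined (odd l) (just (A , z) , W.ω d c j)
        (just (B , w) , W.ω d c ⟦ ι j + 1ℤ ⟧)
      go l e (twice τ) with solve A B A≢B
      ... | i , i≢A , refl = frame-step i A a d c (toℕ z) l (λ e → i≢A (sym e)) (toℕ<n z) (below e)
        (trans (cell-even i A a d c (toℕ z) τ) (cong₂ (λ z x → just (A , z) , x) (Z.⟦ι⟧ z) (here e)))
        (trans (walk-at (cell i A a d c) (toℕ z) (*2-< (*2-cancel-< {τ} {suc l′} (below e))))
          (trans (cell-odd i A a d c (toℕ z) τ)
          (cong₂ (λ w x → just (B , w) , x) (add-diff z w) (there e))))
        where
        a : Fin m
        a = Z.⟦ ι w - ι z ⟧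
      go l e (twice+1 τ) with solve B A (λ e → A≢B (sym e)) | suc τ ℕ.<? suc l′
      ... | i , i≢B , refl | yes τ<l = frame-step i B a d c (toℕ w) l (λ e → i≢B (sym e)) (toℕ<n w)
        (below e)
        (trans (cell-odd i B a d c (toℕ w) τ) (cong₂ (λ z x → just (A , z) , x) (add-diff w z) (here e)))
        (trans (walk-at (cell i B a d c) (toℕ w) (ℕ.<⇒≤ (*2-< τ<l)))
          (trans (cell-even i B a d c (toℕ w) (suc τ))
          (cong₂ (λ w x → just (B , w) , x) (Z.⟦ι⟧ w) (there e))))
        where
        a : Fin m
        a = Z.⟦ ι z - ι w ⟧
      -- The last step of round t leads to the start of round t + 1, so t is w - 1.
      ... | i , i≢B , refl | no τ≮l = frame-step i B a d c (toℕ t) l (λ e → i≢B (sym e)) (toℕ<n t) (below e)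
        (trans (cell-odd i B a d c (toℕ t) τ) (cong₂ (λ z x → just (A , z) , x) (add-diff t z) (here e)))
        (trans (cong (λ l → walk n′ (cell i B a d c) (l ℕ.+ toℕ t ℕ.* N)) l≡)
          (trans (walk-at (cell i B a d c) (suc (toℕ t)) z<s)
          (cong₂ (λ w x → just (B , w) , x) (trans (cong Z.⟦_⟧ (ℤ.+-comm 1ℤ (ι t)))
            (trans (Z.absorb (ι w - 1ℤ) 1ℤ) (Z.⟦ι⟧-cong 0ℤ (l₁ (ι w) (+ m)))))
            (trans (cong (W.ω d c) (trans (sym ⟦N⟧) (cong (λ l → ⟦ + l ⟧) (sym l≡)))) (there e)))))
        where
        t a : Fin m
        t = Z.⟦ ι w - 1ℤ ⟧
        a = Z.⟦ ι z - ι t ⟧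
        l≡ : suc l ≡ N
        l≡ = cong (ℕ._* 2) (ℕ.≤-antisym (*2-cancel-< {τ} {suc l′} (ℕ.<⇒≤ (below e))) (ℕ.≮⇒≥ τ≮l))
        l₁ : ∀ w n → w - 1ℤ + 1ℤ ≡ w + 0ℤ * n
        l₁ = solve-∀

    joins : ∀ v w x y → v ≢ w → x ≢ y → ∀ ℓ → Joined ℓ (v , x) (w , y)
    joins nothing        nothing        x y v≢w x≢y ℓ = ⊥-elim (v≢w refl)
    joins nothing        (just (B , w)) x y v≢w x≢y ℓ = joins-small B nothing (just w) x y (λ ()) x≢y ℓ
    joins (just (A , z)) nothing        x y v≢w x≢y ℓ = joins-small A (just z) nothing x y (λ ()) x≢y ℓ
    joins (just (A , z)) (just (B , w)) x y v≢w x≢y ℓ = go (A ≟ B)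
      where
      go : Dec (A ≡ B) → Joined ℓ (just (A , z) , x) (just (B , w) , y)
      go (yes refl) = joins-small A (just z) (just w) x y (λ e → v≢w (cong (embU A) e)) x≢y ℓ
      go (no A≢B) with W.joins x y x≢y ℓ
      ... | d , c , j , refl , inj₁ (refl , refl) = joins-frame A B z w d c j A≢B
      ... | d , c , j , refl , inj₂ (refl , refl) with joins-frame B A w z d c j (λ e → A≢B (sym e))
      ...   | h , d′ , c′ , q , q<k , l , s = h , d′ , c′ , q , q<k , l , Same-sym s

  framed : Scheme (Maybe (S × Fin (suc m′))) G D (S × C) k
  framed = record { γ = γ ; lab = lab ; closed = closed ; covers = covers ; joins = joins }

-- Finite index sets and the cases of s.

maybe↔ : ∀ {A : Set} {n} → A ↔ Fin n → Maybe A ↔ Fin (suc n)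
maybe↔ {A} {n} i = mk↔ₛ′ to from to-from from-to
  where
  module I = Inverse i
  to : Maybe A → Fin (suc n)
  to nothing  = fz
  to (just x) = fs (I.to x)
  from : Fin (suc n) → Maybe A
  from fz     = nothing
  from (fs j) = just (I.from j)
  to-from : ∀ j → to (from j) ≡ j
  to-from fz     = refl
  to-from (fs j) = cong fs (I.strictlyInverseˡ j)
  from-to : ∀ x → from (to x) ≡ x
  from-to nothing  = refl
  from-to (just x) = cong just (I.strictlyInverseʳ x)

×↔ : ∀ {A B : Set} {a b} → A ↔ Fin a → B ↔ Fin b → (A × B) ↔ Fin (a ℕ.* b)
×↔ i j = ↔-trans (i ×-↔ j) (↔-sym *↔×)

idempotent-empty : Idempotent (Fin 0)
idempotent-empty = record { _≟_ = _≟F_ ; ρ = λ () ; onto = λ () ; solve = λ () }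

module _ (h′ l′ r′ : ℕ) where
  private
    m n r k g g′ : ℕ
    m  = suc (suc h′ ℕ.* 2)
    n  = suc l′ ℕ.* 2
    r  = suc r′
    k  = n ℕ.* m
    g  = suc (suc (r′ ℕ.* 2)) ℕ.* suc l′
    g′ = r′ ℕ.* 2 ℕ.* suc l′ ℕ.+ suc (l′ ℕ.* 2)

    open EvenCycles l′ r′

    g≡ : g ≡ suc g′
    g≡ = arith r′ l′
      where
      arith : ∀ r l → suc (suc (r ℕ.* 2)) ℕ.* suc l ≡ suc (r ℕ.* 2 ℕ.* suc l ℕ.+ suc (l ℕ.* 2))
      arith = solveℕ-∀

    finish : ∀ {U S : Set} {u′ σ} → U ↔ Fin (suc u′) → S ↔ Fin σ → u′ ≡ σ ℕ.* m →
             Scheme U Point Index (S × Fin r) k → ARCS k (suc u′) g 2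
    finish {u′ = u′} {σ} iU iS u′≡ s = scheme⇒ARCS refl g≡
      (transport iU (×↔ (maybe↔ ↔-refl) ↔-refl) (↔-trans (↔-sym *↔× ⊎-↔ ↔-refl) (↔-sym +↔⊎))
        (×↔ iS ↔-refl) s)
      (trans (arith σ r′ l′ m) (cong (ℕ._* g) (sym u′≡)))
      where
      arith : ∀ σ r l m → σ ℕ.* suc r ℕ.* (suc l ℕ.* 2 ℕ.* m) ≡ σ ℕ.* m ℕ.* (suc (suc (r ℕ.* 2)) ℕ.* suc l)
      arith = solveℕ-∀

    framed-ARCS : ∀ {S : Set} σ → S ↔ Fin σ → Idempotent S → ARCS k (suc (σ ℕ.* m)) g 2
    framed-ARCS σ iS quasi = finish (maybe↔ (×↔ iS ↔-refl)) iS refl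
      (Frame.framed {l′ = l′} quasi wheel (ℕ.*-comm n m) (Lift.lifted (NearOne.near h′) wheel))

  construction : ∀ s → ARCS k (suc (s ℕ.* m)) g 2
  construction s = go s (halve s)
    where
    go : ∀ s → Halved s → ARCS k (suc (s ℕ.* m)) g 2
    go _ (twice zero)          = framed-ARCS 0 ↔-refl idempotent-empty
    go _ (twice (suc zero))    = subst (λ u′ → ARCS k (suc u′) g 2) (ℕ.*-comm m 2)
      (finish ↔-refl (↔-sym 2↔Bool) (ℕ.*-comm m 2) (Lift.lifted (NearTwo.near h′) wheel))
    go _ (twice (suc (suc q))) = framed-ARCS _ (maybe↔ ↔-refl) (Prolongation.idempotent-even q)
    go _ (twice+1 q)           = framed-ARCS _ ↔-refl (idempotent-odd q)

product-odd : ∀ ps → All (λ p → ¬ (2 ∣ p)) ps → ¬ (2 ∣ product ps)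
product-odd []       []            (divides zero    ())
product-odd []       []            (divides (suc _) ())
product-odd (p ∷ ps) (p-odd ∷ odds) d with euclidsLemma p (product ps) prime[2] d
... | inj₁ d′ = p-odd d′
... | inj₂ d′ = product-odd ps odds d′

odd-≥3 : ∀ m → m ≢ 1 → ¬ (2 ∣ m) → ∃ λ h′ → m ≡ suc (suc h′ ℕ.* 2)
odd-≥3 m m≢1 m-odd with halve m
... | twice τ           = ⊥-elim (m-odd (divides τ refl))
... | twice+1 zero      = ⊥-elim (m≢1 refl)
... | twice+1 (suc h′)  = h′ , refl

head-prime⇒≢1 : ∀ i ps → 1 ≤ i → i < length ps → All Prime ps → product (take i ps) ≢ 1
head-prime⇒≢1 (suc i) (p ∷ ps) _ _ (p-prime ∷ _) e =
  ¬prime[1] (subst Prime (ℕ.m*n≡1⇒m≡1 p (product (take i ps)) e) p-prime)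

theorem4p9 : (u g k : ℕ) (ps : List ℕ) (i : ℕ) →
    1 ≤ u → 1 ≤ g →
    All Prime ps → k ≡ product ps → 6 ≤ k → 2 ∣ k →
    1 ≤ i → i < length ps →
    All (λ p → ¬ (2 ∣ p)) (take i ps) →
    Any (λ p → p ≡ 2) (drop i ps) →
    product (take i ps) ∣ u ∸ 1 →
    product (drop i ps) ∣ g →
    ARCS k u g 2
theorem4p9 (suc u′) g k ps i _ 1≤g primes k≡ _ _ 1≤i i<t odds two (divides s u≡) (divides r g≡)
  with odd-≥3 (product (take i ps)) (head-prime⇒≢1 i ps 1≤i i<t primes) (product-odd (take i ps) odds)
     | ∈⇒∣product (Any.map sym two)
... | h′ , m≡ | divides l n≡ = go l r n≡ g≡
  where
  go : ∀ l r → product (drop i ps) ≡ l ℕ.* 2 → g ≡ r ℕ.* product (drop i ps) → ARCS k (suc u′) g 2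
  go zero     r        n≡ refl = ⊥-elim (ℕ.<⇒≢ 1≤g (sym (trans (cong (r ℕ.*_) n≡) (ℕ.*-zeroʳ r))))
  go (suc l′) zero     n≡ refl = ⊥-elim (ℕ.<⇒≢ 1≤g refl)
  go (suc l′) (suc r′) n≡ g≡   = subst (λ k → ARCS k (suc u′) g 2) (sym k≡nm)
    (subst₂ (λ u′ g → ARCS _ (suc u′) g 2) (sym (trans u≡ (cong (s ℕ.*_) m≡)))
      (sym (trans g≡ (trans (cong (suc r′ ℕ.*_) n≡) (arith r′ l′))))
      (construction h′ l′ r′ s))
    where
    arith : ∀ r l → suc r ℕ.* (suc l ℕ.* 2) ≡ suc (suc (r ℕ.* 2)) ℕ.* suc l
    arith = solveℕ-∀
    k≡nm : k ≡ suc l′ ℕ.* 2 ℕ.* suc (suc h′ ℕ.* 2)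
    k≡nm = trans k≡ (trans (cong product (sym (take++drop≡id i ps)))
      (trans (product-++ (take i ps) (drop i ps))
      (trans (cong₂ ℕ._*_ m≡ n≡) (ℕ.*-comm (suc (suc h′ ℕ.* 2)) (suc l′ ℕ.* 2)))))
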